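{- For any even $m\geq 2$, the subgraph $H_m$ of $G_m^{M}$ consisting of all arcs that correspond to centered flips has no edges between any two of the classes $\mathcal{M}^+_{m,c}$, $c=0,1,\dots,m-2$. Consequently $H_m$ has at least one connected component within each class $\mathcal{M}^+_{m,c}$, and in total at least $m-1$ connected components.
   Context: Let $n=2m$ points be equally spaced on a unit circle centered at the origin, labeled clockwise $1,\dots,n$. $\mathcal{M}_m$ is the set of non-crossing perfect matchings on these points. $G_m^{M}$ is the directed graph on $\mathcal{M}_m$ with an arc $(M,M')$ whenever $M'$ arises from $M$ by replacing two edges $\{a,b\},\{c,d\}\in M$ by $\{a,c\},\{b,d\}$ (a flip). The length $\ell(e)$ of an edge $e=\{i,j\}$ with $j-i$ odd is the minimum over the two sides of $e$ of (number of points strictly on that side)$/2$. A flip is centered if the four edges involved (two removed, two added), which form a convex quadrilateral, have lengths summing to $m-2$. $H_m$ has vertex set $\mathcal{M}_m$ and only the arcs of centered flips. For an edge $e$ with endpoints $i,j$ named so that the origin lies to the right of the ray from $i$ to $j$, $\mathrm{sgn}(e)=+1$ if $i$ is odd and $-1$ if $i$ is even; the weight is $w(M)=\sum_{e\in M}\mathrm{sgn}(e)\ell(e)$. $\mathcal{M}_{m,c}$ is the set of matchings of weight exactly $c$, and $\mathcal{M}^+_{m,c}:=\mathcal{M}_{m,c}\cup\mathcal{M}_{m,c-(m-2)}$ for $c=0,1,\dots,m-2$.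
   Formalization: The classes for c=0 and c=m-2 share the weight-0 matchings, and for m≥4 there are arcs from weight 0 to weight -(m-2), so "no edges between any two classes" is stated as: every arc of H_m has both ends in a common class; the component claims are unchanged. -}

module Defs where

open import Data.Nat using (ℕ; zero; suc; _+_; _*_; _∸_; _≤_; _<_; _<ᵇ_; ∣_-_∣; _⊓_; _/_; _%_)
open import Data.Fin using (Fin; toℕ)
import Data.Fin as F
open import Data.Bool using (Bool; true; false; if_then_else_)
open import Data.Integer using (ℤ; +_; -_) renaming (_+_ to _+ℤ_)
open import Data.List using (List; map; foldr; allFin)
open import Data.Product using (Σ; ∃; ∃-syntax; _×_)
open import Data.Sum using (_⊎_)
open import Relation.Binary.PropositionalEquality using (_≡_; _≢_)
open import Relation.Binary.Construct.Closure.ReflexiveTransitive using (Star)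

-- Points 1,…,n (n = 2m) are represented by Fin (2 * m): index k stands for label k+1.
-- A non-crossing perfect matching is given by its partner function p
-- (an involution without fixed points) whose chords do not cross.
record Matching (m : ℕ) : Set where
  field
    p        : Fin (2 * m) → Fin (2 * m)
    invol    : ∀ i → p (p i) ≡ i
    noFix    : ∀ i → p i ≢ i
    nonCross : ∀ i j → i F.< j → j F.< p i → (i F.< p j × p j F.< p i)

open Matching public

-- length of the edge {x,y} on 2m points: with d = |x - y|, the two sides contain
-- d - 1 and 2m - d - 1 points; ℓ = min(d - 1, 2m - d - 1) / 2
len : (m : ℕ) → Fin (2 * m) → Fin (2 * m) → ℕ
len m x y = ((d ⊓ (2 * m ∸ d)) ∸ 1) / 2
  where d = ∣ toℕ x - toℕ y ∣

-- the index of the endpoint i of {x,y} such that the origin lies to the right of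
-- the ray i → j (points labelled clockwise): i is the endpoint from which the
-- other one is reached clockwise along the short arc, i.e. (j - i) mod 2m < m.
tailIdx : (m : ℕ) → Fin (2 * m) → Fin (2 * m) → ℕ
tailIdx m x y =
  if toℕ x <ᵇ toℕ y
  then (if (toℕ y ∸ toℕ x) <ᵇ m then toℕ x else toℕ y)
  else (if (toℕ x ∸ toℕ y) <ᵇ m then toℕ y else toℕ x)

-- sgn(e) ℓ(e) : +ℓ if the label (index + 1) of the tail is odd, i.e. the index is even
signedLen : (m : ℕ) → Fin (2 * m) → Fin (2 * m) → ℤ
signedLen m x y with tailIdx m x y % 2
... | zero  = + len m x y
... | suc _ = - (+ len m x y)

weight : {m : ℕ} → Matching m → ℤ
weight {m} M = foldr _+ℤ_ (+ 0) (map term (allFin (2 * m)))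
  where
  term : Fin (2 * m) → ℤ
  term i = if toℕ i <ᵇ toℕ (p M i) then signedLen m i (p M i) else + 0

InClass : (m c : ℕ) → Matching m → Set
InClass m c M = (weight M ≡ + c) ⊎ (weight M ≡ (+ c) Data.Integer.- (+ (m ∸ 2)))

record Flip {m : ℕ} (M M' : Matching m) (a b c d : Fin (2 * m)) : Set where
  field
    ab    : p M a ≡ b
    cd    : p M c ≡ d
    a≢c   : a ≢ c
    a≢d   : a ≢ d
    ac    : p M' a ≡ c
    bd    : p M' b ≡ d
    other : ∀ x → x ≢ a → x ≢ b → x ≢ c → x ≢ d → p M' x ≡ p M x

CenteredFlip : {m : ℕ} → Matching m → Matching m → Set
CenteredFlip {m} M M' =
  ∃[ a ] ∃[ b ] ∃[ c ] ∃[ d ]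
    (Flip M M' a b c d × len m a b + len m c d + len m a c + len m b d ≡ m ∸ 2)

SameMatching : {m : ℕ} → Matching m → Matching m → Set
SameMatching M M' = ∀ x → p M x ≡ p M' x

Step : {m : ℕ} → Matching m → Matching m → Set
Step M M' = CenteredFlip M M' ⊎ CenteredFlip M' M ⊎ SameMatching M M'

Connected : {m : ℕ} → Matching m → Matching m → Set
Connected = Star Step

{-# OPTIONS --safe #-}
module Submission where

-- Number the points 0, …, 2m-1.  An edge {x < y} of a non-crossing matching has y - x odd,
-- since the points between x and y are matched among themselves; call it long if y - x > m.
-- Writing σ x = (-1)^x, its signed length is
-- σ x ((y - x - 1)/2 - (m - 1) [long]).  Since σ y = -σ x, summing the first part over all
-- edges gives N, the number of edges whose smaller endpoint x is odd.  The long edges are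
-- nested with alternating signs, starting with +, so that κ = Σ σ x over the long edges is
-- 0 or 1, and the weight is N - (m - 1) κ = (N - κ) - (m - 2) κ.
-- In a centered flip on a < b < d < c exactly the edge {a,c} is long, so N and κ both change
-- by ± σ a.  Hence c = N - κ is constant on components, and it lies between 0 and m - 2
-- because one end of the flip has κ = 0, the other κ = 1, and 0 ≤ N ≤ m - 1.

open import Defs
open import Algebra.Bundles using (CommutativeRing)
open import Data.Bool using (Bool; true; false; if_then_else_)
open import Data.Fin using (Fin; zero; suc; toℕ; fromℕ<; _≟_)
open import Data.Fin.Permutation using (permutation)
open import Data.Fin.Properties using (toℕ-injective; toℕ<n; toℕ-fromℕ<; suc-injective)
open import Data.Integer using (ℤ; +_; -_; 0ℤ; 1ℤ; -1ℤ; _+_; _-_; _*_)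
import Data.Integer as ℤ
import Data.Integer.Properties as ℤ
open import Data.Integer.Tactic.RingSolver using (solve-∀)
open import Data.List using (map; foldr; allFin; tabulate)
open import Data.List.Properties using (map-tabulate)
open import Data.Nat using (ℕ; zero; suc; _≤_; _<_; _∸_; _<ᵇ_; s≤s; z≤n)
import Data.Nat as ℕ
import Data.Nat.DivMod as ℕ
import Data.Nat.Properties as ℕ
open import Data.Nat.Divisibility using (_∣_; divides)
open import Data.Nat.Tactic.RingSolver using () renaming (solve-∀ to solveℕ-∀)
open import Data.Product using (∃-syntax; Σ-syntax; _×_; _,_; proj₁; proj₂)
open import Data.Sum using (_⊎_; inj₁; inj₂)
open import Function using (_∘_; id)
open import Relation.Binary.Construct.Closure.ReflexiveTransitive using (ε; _◅_)
open import Relation.Binary.Definitions using (tri<; tri≈; tri>)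
open import Relation.Binary.PropositionalEquality using (_≡_; _≢_; refl; sym; trans; cong; cong₂; subst; subst₂; module ≡-Reasoning)
open import Relation.Nullary using (¬_; yes; no; contradiction)
open import Relation.Nullary.Decidable using (⌊_⌋)
open import Algebra.Properties.Semiring.Sum (CommutativeRing.semiring ℤ.+-*-commutativeRing) using (sum; sum-cong-≗; sum-replicate-zero; ∑-distrib-+; sum-permute; *-distribˡ-sum)

-- Boolean comparisons, truncated subtraction and case selection.

when : Bool → ℤ → ℤ
when b x = if b then x else 0ℤ

<ᵇ-true : ∀ {a b} → a < b → (a <ᵇ b) ≡ true
<ᵇ-true {zero}  {suc b} _         = refl
<ᵇ-true {suc a} {suc b} (s≤s a<b) = <ᵇ-true a<b

<ᵇ-false : ∀ {a b} → b ≤ a → (a <ᵇ b) ≡ false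
<ᵇ-false {a}     {zero}  _         = refl
<ᵇ-false {suc a} {suc b} (s≤s b≤a) = <ᵇ-false b≤a

<ᵇ-view : ∀ a b → (a < b × (a <ᵇ b) ≡ true) ⊎ (b ≤ a × (a <ᵇ b) ≡ false)
<ᵇ-view a b with ℕ.<-≤-connex a b
... | inj₁ a<b = inj₁ (a<b , <ᵇ-true a<b)
... | inj₂ b≤a = inj₂ (b≤a , <ᵇ-false b≤a)

<ᵇ-true⁻¹ : ∀ {a b} → (a <ᵇ b) ≡ true → a < b
<ᵇ-true⁻¹ {a} {b} eq with <ᵇ-view a b
... | inj₁ (a<b , _)  = a<b
... | inj₂ (_ , eq′) with trans (sym eq) eq′
...   | ()

<-∸⇒+-< : ∀ {a b} c → a < b ∸ c → c ℕ.+ a < b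
<-∸⇒+-< {a} {b} c a<b∸c = subst (c ℕ.+ a <_) (ℕ.m+[n∸m]≡n c≤b) (ℕ.+-monoʳ-< c a<b∸c)
  where
  c≤b : c ≤ b
  c≤b = ℕ.<⇒≤ (ℕ.m∸n≢0⇒n<m (λ b∸c≡0 → ℕ.n≮0 (subst (a <_) b∸c≡0 a<b∸c)))

-- The tail is searched before the head, so the witness found is the largest index. It later selects
-- the long edge whose smaller endpoint is largest.
last-true : ∀ {n} (f : Fin n → Bool) →
            (∀ i → f i ≡ false) ⊎ (∃[ i ] (f i ≡ true × (∀ j → toℕ i < toℕ j → f j ≡ false)))
last-true {zero}  f = inj₁ λ ()
last-true {suc n} f with last-true (f ∘ suc)
... | inj₂ (i , fi , later) = inj₂ (suc i , fi , λ { (suc j) (s≤s i<j) → later j i<j })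
... | inj₁ none with f zero in eq
...   | true  = inj₂ (zero , eq , λ { (suc j) _ → none j })
...   | false = inj₁ λ { zero → eq ; (suc i) → none i }

when-true : ∀ {b x} → b ≡ true → when b x ≡ x
when-true refl = refl

when-false : ∀ {b x} → b ≡ false → when b x ≡ 0ℤ
when-false refl = refl

when-0 : ∀ b → when b 0ℤ ≡ 0ℤ
when-0 false = refl
when-0 true  = refl

when-+ : ∀ b x y → when b (x + y) ≡ when b x + when b y
when-+ false x y = refl
when-+ true  x y = refl

-- Finite sums of integers

sum-zero : ∀ {n} (f : Fin n → ℤ) → (∀ i → f i ≡ 0ℤ) → sum f ≡ 0ℤ
sum-zero {n} f f≡0 = trans (sum-cong-≗ f≡0) (sum-replicate-zero n)

sum-nonNeg : ∀ {n} (f : Fin n → ℤ) → (∀ i → 0ℤ ℤ.≤ f i) → 0ℤ ℤ.≤ sum f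
sum-nonNeg {zero}  f 0≤f = ℤ.≤-refl
sum-nonNeg {suc n} f 0≤f = ℤ.+-mono-≤ (0≤f zero) (sum-nonNeg (f ∘ suc) (0≤f ∘ suc))

sum-≥-head : ∀ {n} (f : Fin n → ℤ) → (∀ i → 0ℤ ℤ.≤ f i) → ∀ i → toℕ i ≡ 0 → f i ℤ.≤ sum f
sum-≥-head {suc n} f 0≤f zero _ = subst (ℤ._≤ sum f) (ℤ.+-identityʳ (f zero)) (ℤ.+-monoʳ-≤ (f zero) (sum-nonNeg (f ∘ suc) (0≤f ∘ suc)))

sum-neg : ∀ {n} (f : Fin n → ℤ) → sum (λ i → - f i) ≡ - sum f
sum-neg {zero}  f = refl
sum-neg {suc n} f = trans (cong (_+_ (- f zero)) (sum-neg (f ∘ suc))) (sym (ℤ.neg-distrib-+ (f zero) (sum (f ∘ suc))))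

sum-head : ∀ {n} (f : Fin n → ℤ) → 0 < n → {z : ℤ} → (∀ i → toℕ i ≡ 0 → f i ≡ z) → (∀ i → toℕ i ≢ 0 → f i ≡ 0ℤ) → sum f ≡ z
sum-head {suc n} f _ {z} first rest = trans (cong₂ _+_ (first zero refl) (sum-zero (f ∘ suc) (λ i → rest (suc i) λ ()))) (ℤ.+-identityʳ z)

sum-minus : ∀ {n} (f g : Fin n → ℤ) → sum (λ i → f i - g i) ≡ sum f - sum g
sum-minus f g = trans (∑-distrib-+ f (λ i → - g i)) (cong (_+_ (sum f)) (sum-neg g))

sum-erase : ∀ {n} (a : Fin n) (f g : Fin n → ℤ) →
            g a ≡ 0ℤ → (∀ i → i ≢ a → g i ≡ f i) → sum f ≡ f a + sum g
sum-erase zero f g ga≡0 g≡f = cong (_+_ (f zero))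
  (trans (sum-cong-≗ (λ i → sym (g≡f (suc i) λ ())))
    (sym (trans (cong (_+ sum (g ∘ suc)) ga≡0) (ℤ.+-identityˡ _))))
sum-erase (suc a) f g ga≡0 g≡f = begin
  f zero + sum (f ∘ suc)                ≡⟨ cong (_+_ (f zero)) (sum-erase a (f ∘ suc) (g ∘ suc) ga≡0 (λ i i≢a → g≡f (suc i) (i≢a ∘ suc-injective))) ⟩
  f zero + (f (suc a) + sum (g ∘ suc))  ≡⟨ swap (f zero) (f (suc a)) (sum (g ∘ suc)) ⟩
  f (suc a) + (f zero + sum (g ∘ suc))  ≡⟨ cong (λ z → f (suc a) + (z + sum (g ∘ suc))) (g≡f zero λ ()) ⟨
  f (suc a) + (g zero + sum (g ∘ suc))  ∎
  where
  open ≡-Reasoning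
  swap : ∀ x y z → x + (y + z) ≡ y + (x + z)
  swap = solve-∀

erase : ∀ {n} → Fin n → (Fin n → ℤ) → Fin n → ℤ
erase a f i = if ⌊ i ≟ a ⌋ then 0ℤ else f i

erase-≡ : ∀ {n} (a : Fin n) f → erase a f a ≡ 0ℤ
erase-≡ a f with a ≟ a
... | yes _  = refl
... | no a≢a = contradiction refl a≢a

erase-≢ : ∀ {n} (a : Fin n) f i → i ≢ a → erase a f i ≡ f i
erase-≢ a f i i≢a with i ≟ a
... | yes i≡a = contradiction i≡a i≢a
... | no _    = refl

-- Erases the four points one after another; distinctness ensures that the earlier erasures leave
-- the later values intact. A flip changes partners at exactly four points, which is where this is
-- applied.
sum-support₄ : ∀ {n} (f : Fin n → ℤ) {a b c d : Fin n} →
  a ≢ b → a ≢ c → a ≢ d → b ≢ c → b ≢ d → c ≢ d →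
  (∀ x → x ≢ a → x ≢ b → x ≢ c → x ≢ d → f x ≡ 0ℤ) →
  sum f ≡ f a + (f b + (f c + f d))
sum-support₄ f {a} {b} {c} {d} a≢b a≢c a≢d b≢c b≢d c≢d f≡0 = begin
  sum f                                   ≡⟨ pull a f ⟩
  f a + sum f₁                            ≡⟨ cong (_+_ (f a)) (pull b f₁) ⟩
  f a + (f₁ b + sum f₂)                   ≡⟨ cong (λ z → f a + (f₁ b + z)) (pull c f₂) ⟩
  f a + (f₁ b + (f₂ c + sum f₃))          ≡⟨ cong (λ z → f a + (f₁ b + (f₂ c + z))) (pull d f₃) ⟩
  f a + (f₁ b + (f₂ c + (f₃ d + sum f₄))) ≡⟨ cong (λ z → f a + (f₁ b + (f₂ c + (f₃ d + z)))) (sum-zero f₄ f₄≡0) ⟩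
  f a + (f₁ b + (f₂ c + (f₃ d + 0ℤ)))     ≡⟨ cong (λ z → f a + (f₁ b + (f₂ c + z))) (ℤ.+-identityʳ (f₃ d)) ⟩
  f a + (f₁ b + (f₂ c + f₃ d))            ≡⟨ cong (_+_ (f a)) (cong₂ _+_ f₁b (cong₂ _+_ f₂c f₃d)) ⟩
  f a + (f b + (f c + f d))               ∎
  where
  open ≡-Reasoning
  f₁ = erase a f
  f₂ = erase b f₁
  f₃ = erase c f₂
  f₄ = erase d f₃
  pull : ∀ v g → sum g ≡ g v + sum (erase v g)
  pull v g = sum-erase v g (erase v g) (erase-≡ v g) (erase-≢ v g)
  f₁b : f₁ b ≡ f b
  f₁b = erase-≢ a f b (a≢b ∘ sym)
  f₂c : f₂ c ≡ f c
  f₂c = trans (erase-≢ b f₁ c (b≢c ∘ sym)) (erase-≢ a f c (a≢c ∘ sym))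
  f₃d : f₃ d ≡ f d
  f₃d = trans (erase-≢ c f₂ d (c≢d ∘ sym)) (trans (erase-≢ b f₁ d (b≢d ∘ sym)) (erase-≢ a f d (a≢d ∘ sym)))
  f₄≡0 : ∀ x → f₄ x ≡ 0ℤ
  f₄≡0 x with x ≟ d
  ... | yes _ = refl
  ... | no x≢d with x ≟ c
  ...   | yes _ = refl
  ...   | no x≢c with x ≟ b
  ...     | yes _ = refl
  ...     | no x≢b with x ≟ a
  ...       | yes _ = refl
  ...       | no x≢a = f≡0 x x≢a x≢b x≢c x≢d

foldr-tabulate : ∀ {n} (f : Fin n → ℤ) → foldr _+_ 0ℤ (tabulate f) ≡ sum f
foldr-tabulate {zero}  f = refl
foldr-tabulate {suc n} f = cong (_+_ (f zero)) (foldr-tabulate (f ∘ suc))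

foldr-allFin : ∀ {n} (f : Fin n → ℤ) → foldr _+_ 0ℤ (map f (allFin n)) ≡ sum f
foldr-allFin {n} f = trans (cong (foldr _+_ 0ℤ) (map-tabulate id f)) (foldr-tabulate f)

-- Sums over an initial segment of the naturals, where summands depending on parity can be peeled
-- off two at a time. `sum-toℕ` and `sum-below` lead from sums over points to these.
Σ< : ℕ → (ℕ → ℤ) → ℤ
Σ< zero    f = 0ℤ
Σ< (suc t) f = f 0 + Σ< t (f ∘ suc)

Σ<-cong : ∀ t {f g : ℕ → ℤ} → (∀ i → f i ≡ g i) → Σ< t f ≡ Σ< t g
Σ<-cong zero    f≡g = refl
Σ<-cong (suc t) f≡g = cong₂ _+_ (f≡g 0) (Σ<-cong t (f≡g ∘ suc))

sum-toℕ : ∀ n (f : ℕ → ℤ) → sum {n} (f ∘ toℕ) ≡ Σ< n f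
sum-toℕ zero    f = refl
sum-toℕ (suc n) f = cong (_+_ (f 0)) (sum-toℕ n (f ∘ suc))

sum-below : ∀ {n} t (f : ℕ → ℤ) → t ≤ n →
            sum {n} (λ i → when (toℕ i <ᵇ t) (f (toℕ i))) ≡ Σ< t f
sum-below {n}     zero    f _         = sum-replicate-zero n
sum-below {suc n} (suc t) f (s≤s t≤n) = cong (_+_ (f 0)) (sum-below t (f ∘ suc) t≤n)

-- Parity

odd : ℕ → ℤ
odd zero          = 0ℤ
odd (suc zero)    = 1ℤ
odd (suc (suc n)) = odd n

σ : ℕ → ℤ
σ zero          = 1ℤ
σ (suc zero)    = -1ℤ
σ (suc (suc n)) = σ n

0≤odd : ∀ n → 0ℤ ℤ.≤ odd n
0≤odd zero          = ℤ.+≤+ z≤n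
0≤odd (suc zero)    = ℤ.+≤+ z≤n
0≤odd (suc (suc n)) = 0≤odd n

odd-01 : ∀ n → odd n ≡ 0ℤ ⊎ odd n ≡ 1ℤ
odd-01 zero          = inj₁ refl
odd-01 (suc zero)    = inj₂ refl
odd-01 (suc (suc n)) = odd-01 n

σ-suc : ∀ n → σ (suc n) ≡ - σ n
σ-suc zero          = refl
σ-suc (suc zero)    = refl
σ-suc (suc (suc n)) = σ-suc n

σ≡odd-suc-odd : ∀ n → σ n ≡ odd (suc n) - odd n
σ≡odd-suc-odd zero          = refl
σ≡odd-suc-odd (suc zero)    = refl
σ≡odd-suc-odd (suc (suc n)) = σ≡odd-suc-odd n

σ-even+ : ∀ k n → σ (k ℕ.* 2 ℕ.+ n) ≡ σ n
σ-even+ zero    n = refl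
σ-even+ (suc k) n = σ-even+ k n

odd-even+ : ∀ k n → odd (k ℕ.* 2 ℕ.+ n) ≡ odd n
odd-even+ zero    n = refl
odd-even+ (suc k) n = odd-even+ k n

Σ<-1 : ∀ t → Σ< t (λ _ → 1ℤ) ≡ + t
Σ<-1 zero    = refl
Σ<-1 (suc t) = cong (_+_ 1ℤ) (Σ<-1 t)

Σ<-σ : ∀ t → Σ< t σ ≡ odd t
Σ<-σ zero          = refl
Σ<-σ (suc zero)    = refl
Σ<-σ (suc (suc t)) = trans (cancel (Σ< t σ)) (Σ<-σ t)
  where
  cancel : ∀ z → 1ℤ + (-1ℤ + z) ≡ z
  cancel z = trans (sym (ℤ.+-assoc 1ℤ -1ℤ z)) (ℤ.+-identityˡ z)

Σ<-odd : ∀ k → Σ< (k ℕ.* 2) odd ≡ + k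
Σ<-odd zero    = refl
Σ<-odd (suc k) = trans (ℤ.+-identityˡ _) (cong (_+_ 1ℤ) (Σ<-odd k))

Σ<-odd-suc : ∀ k → Σ< (suc (k ℕ.* 2)) odd ≡ + k
Σ<-odd-suc zero    = refl
Σ<-odd-suc (suc k) = trans (ℤ.+-identityˡ _) (cong (_+_ 1ℤ) (Σ<-odd-suc k))

-- Consecutive terms pair up to -1 each. The offset `z` makes the induction go through, since
-- peeling off a pair shifts it by 2; only `z` = 0 is needed in the end.
Σ<-σ* : ∀ k z → Σ< (k ℕ.* 2) (λ i → σ i * (z + + i)) ≡ - (+ k)
Σ<-σ* zero    z = refl
Σ<-σ* (suc k) z = begin
  1ℤ * (z + 0ℤ) + (-1ℤ * (z + 1ℤ) + Σ< (k ℕ.* 2) (λ i → σ i * (z + + (2 ℕ.+ i))))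
    ≡⟨ cong (λ s → 1ℤ * (z + 0ℤ) + (-1ℤ * (z + 1ℤ) + s)) (Σ<-cong (k ℕ.* 2) (λ i → cong (_*_ (σ i)) (shift (+ i)))) ⟩
  1ℤ * (z + 0ℤ) + (-1ℤ * (z + 1ℤ) + Σ< (k ℕ.* 2) (λ i → σ i * ((z + + 2) + + i)))
    ≡⟨ cong (λ s → 1ℤ * (z + 0ℤ) + (-1ℤ * (z + 1ℤ) + s)) (Σ<-σ* k (z + + 2)) ⟩
  1ℤ * (z + 0ℤ) + (-1ℤ * (z + 1ℤ) + - (+ k))
    ≡⟨ collect z (+ k) ⟩
  - (1ℤ + + k) ∎
  where
  open ≡-Reasoning
  shift : ∀ x → z + (+ 2 + x) ≡ (z + + 2) + x
  shift x = sym (ℤ.+-assoc z (+ 2) x)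
  collect : ∀ z k → 1ℤ * (z + 0ℤ) + (-1ℤ * (z + 1ℤ) + - k) ≡ - (1ℤ + k)
  collect = solve-∀

-- Sums over a matching

opens : {m : ℕ} → Matching m → Fin (2 ℕ.* m) → Bool
opens M i = toℕ i <ᵇ toℕ (p M i)

module _ {m : ℕ} (M : Matching m) where

  p-≢ : ∀ i → toℕ i ≢ toℕ (p M i)
  p-≢ i i≡pi = noFix M i (sym (toℕ-injective i≡pi))

  -- Every point either opens or closes its edge. Reindexing the closing part by the involution
  -- `p M` moves its values to the opening ends.
  sum-pairs : ∀ g → sum g ≡ sum (λ i → when (opens M i) (g i + g (p M i)))
  sum-pairs g = begin
    sum g
      ≡⟨ sum-cong-≗ split ⟩
    sum (λ i → opening i + closing i)
      ≡⟨ ∑-distrib-+ opening closing ⟩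
    sum opening + sum closing
      ≡⟨ cong (_+_ (sum opening)) (sum-permute closing (permutation (p M) (p M) (invol M) (invol M))) ⟩
    sum opening + sum (closing ∘ p M)
      ≡⟨ cong (_+_ (sum opening)) (sum-cong-≗ (λ i → cong (λ j → when (toℕ j <ᵇ toℕ (p M i)) (g (p M i))) (invol M i))) ⟩
    sum opening + sum partner
      ≡⟨ ∑-distrib-+ opening partner ⟨
    sum (λ i → opening i + partner i)
      ≡⟨ sum-cong-≗ (λ i → sym (when-+ (opens M i) (g i) (g (p M i)))) ⟩
    sum (λ i → when (opens M i) (g i + g (p M i)))
      ∎
    where
    open ≡-Reasoning
    opening closing partner : Fin (2 ℕ.* m) → ℤ
    opening i = when (opens M i) (g i)
    closing i = when (toℕ (p M i) <ᵇ toℕ i) (g i)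
    partner i = when (opens M i) (g (p M i))
    split : ∀ i → g i ≡ when (opens M i) (g i) + when (toℕ (p M i) <ᵇ toℕ i) (g i)
    split i with ℕ.<-cmp (toℕ i) (toℕ (p M i))
    ... | tri< i<pi _ _ rewrite <ᵇ-true i<pi | <ᵇ-false (ℕ.<⇒≤ i<pi) = sym (ℤ.+-identityʳ (g i))
    ... | tri≈ _ i≡pi _ = contradiction i≡pi (p-≢ i)
    ... | tri> _ _ pi<i rewrite <ᵇ-true pi<i | <ᵇ-false (ℕ.<⇒≤ pi<i) = sym (ℤ.+-identityˡ (g i))

  -- By `nonCross`, the points strictly between the ends are matched among themselves, so their
  -- number is even. The proof counts them with the indicator function `g`, which is invariant under
  -- `p M`.
  edge-odd : ∀ i → toℕ i < toℕ (p M i) → ∃[ k ] toℕ (p M i) ≡ suc (k ℕ.* 2 ℕ.+ toℕ i)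
  edge-odd i i<pi = k , ℤ.+-injective (begin
    + y                                  ≡⟨ Σ<-1 y ⟨
    Σ< y (λ _ → 1ℤ)                      ≡⟨ sum-below {2 ℕ.* m} y (λ _ → 1ℤ) (ℕ.<⇒≤ (toℕ<n (p M i))) ⟨
    sum {2 ℕ.* m} (λ j → when (toℕ j <ᵇ y) 1ℤ)     ≡⟨ sum-cong-≗ cut ⟩
    sum (λ j → when (toℕ j <ᵇ suc x) 1ℤ + g j)
      ≡⟨ ∑-distrib-+ (λ j → when (toℕ j <ᵇ suc x) 1ℤ) g ⟩
    sum {2 ℕ.* m} (λ j → when (toℕ j <ᵇ suc x) 1ℤ) + sum g
      ≡⟨ cong₂ _+_ (trans (sum-below (suc x) (λ _ → 1ℤ) (toℕ<n i)) (Σ<-1 (suc x))) Σg≡2S ⟩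
    + suc x + S * + 2                    ≡⟨ cong (λ s → + suc x + s * + 2) (ℤ.0≤i⇒+∣i∣≡i 0≤S) ⟨
    + suc x + + k * + 2                  ≡⟨ cong (_+_ (+ suc x)) (ℤ.pos-* k 2) ⟨
    + (suc x ℕ.+ k ℕ.* 2)                ≡⟨ cong (+_ ∘ suc) (ℕ.+-comm x (k ℕ.* 2)) ⟩
    + suc (k ℕ.* 2 ℕ.+ x)                ∎)
    where
    open ≡-Reasoning
    x = toℕ i
    y = toℕ (p M i)
    g : Fin (2 ℕ.* m) → ℤ
    g j = when (x <ᵇ toℕ j) (when (toℕ j <ᵇ y) 1ℤ)
    Inside : Fin (2 ℕ.* m) → Set
    Inside j = x < toℕ j × toℕ j < y
    inside-p : ∀ j → Inside j → Inside (p M j)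
    inside-p j (x<j , j<y) = nonCross M i j x<j j<y
    g-inside : ∀ j → Inside j → g j ≡ 1ℤ
    g-inside j (x<j , j<y) = trans (when-true (<ᵇ-true x<j)) (when-true (<ᵇ-true j<y))
    g-outside : ∀ j → ¬ Inside j → g j ≡ 0ℤ
    g-outside j ¬in with <ᵇ-view x (toℕ j)
    ... | inj₂ (_ , eq) rewrite eq = refl
    ... | inj₁ (x<j , eq) rewrite eq = when-false (<ᵇ-false (ℕ.≮⇒≥ (λ j<y → ¬in (x<j , j<y))))
    outside-p : ∀ j → ¬ Inside j → g (p M j) ≡ g j
    outside-p j ¬in = trans
      (g-outside (p M j) (λ in′ → ¬in (subst Inside (invol M j) (inside-p (p M j) in′))))
      (sym (g-outside j ¬in))
    g-p : ∀ j → g (p M j) ≡ g j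
    g-p j with ℕ._<?_ x (toℕ j) | ℕ._<?_ (toℕ j) y
    ... | yes x<j | yes j<y = trans (g-inside (p M j) (inside-p j (x<j , j<y))) (sym (g-inside j (x<j , j<y)))
    ... | yes _ | no j≮y = outside-p j (j≮y ∘ proj₂)
    ... | no x≮j | _     = outside-p j (x≮j ∘ proj₁)
    -- `S` is the number of edges strictly inside. It is an integer, so its absolute value serves as
    -- the natural witness, and `0≤S` shows that nothing is lost.
    S = sum (λ j → when (opens M j) (g j))
    k = ℤ.∣ S ∣
    0≤g : ∀ j → 0ℤ ℤ.≤ g j
    0≤g j with x <ᵇ toℕ j
    ... | false = ℤ.+≤+ z≤n
    ... | true with toℕ j <ᵇ y
    ...   | false = ℤ.+≤+ z≤n
    ...   | true  = ℤ.+≤+ z≤n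
    0≤S : 0ℤ ℤ.≤ S
    0≤S = sum-nonNeg _ nonNeg
      where
      nonNeg : ∀ j → 0ℤ ℤ.≤ when (opens M j) (g j)
      nonNeg j with opens M j
      ... | false = ℤ.+≤+ z≤n
      ... | true  = 0≤g j
    double : ∀ s → s + s ≡ s * + 2
    double = solve-∀
    Σg≡2S : sum g ≡ S * + 2
    Σg≡2S = begin
      sum g                                               ≡⟨ sum-pairs g ⟩
      sum (λ j → when (opens M j) (g j + g (p M j)))      ≡⟨ sum-cong-≗ (λ j → trans (cong (λ z → when (opens M j) (g j + z)) (g-p j)) (when-+ (opens M j) (g j) (g j))) ⟩
      sum (λ j → when (opens M j) (g j) + when (opens M j) (g j))
        ≡⟨ ∑-distrib-+ (λ j → when (opens M j) (g j)) _ ⟩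
      S + S                                               ≡⟨ double S ⟩
      S * + 2                                             ∎
    cut : ∀ j → when (toℕ j <ᵇ y) 1ℤ ≡ when (toℕ j <ᵇ suc x) 1ℤ + g j
    cut j with <ᵇ-view x (toℕ j)
    ... | inj₁ (x<j , eq) rewrite eq | <ᵇ-false x<j = sym (ℤ.+-identityˡ _)
    ... | inj₂ (j≤x , eq) rewrite eq | <ᵇ-true (s≤s j≤x) | <ᵇ-true (ℕ.≤-<-trans j≤x i<pi) = refl

  σ-p : ∀ i → σ (toℕ (p M i)) ≡ - σ (toℕ i)
  σ-p i with ℕ.<-cmp (toℕ i) (toℕ (p M i))
  ... | tri< i<pi _ _ with edge-odd i i<pi
  ...   | k , eq rewrite eq = trans (σ-suc (k ℕ.* 2 ℕ.+ toℕ i)) (cong -_ (σ-even+ k (toℕ i)))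
  σ-p i | tri≈ _ i≡pi _ = contradiction i≡pi (p-≢ i)
  σ-p i | tri> _ _ pi<i with edge-odd (p M i) (subst (λ j → toℕ (p M i) < toℕ j) (sym (invol M i)) pi<i)
  ...   | k , eq = begin
      σ (toℕ (p M i))                           ≡⟨ σ-even+ k (toℕ (p M i)) ⟨
      σ (k ℕ.* 2 ℕ.+ toℕ (p M i))               ≡⟨ ℤ.neg-involutive _ ⟨
      - (- σ (k ℕ.* 2 ℕ.+ toℕ (p M i)))         ≡⟨ cong -_ (σ-suc (k ℕ.* 2 ℕ.+ toℕ (p M i))) ⟨
      - σ (suc (k ℕ.* 2 ℕ.+ toℕ (p M i)))       ≡⟨ cong (-_ ∘ σ) (trans (sym eq) (cong toℕ (invol M i))) ⟩
      - σ (toℕ i)                               ∎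
    where open ≡-Reasoning

-- The quantities N and κ of a matching.

edgeSum : {m : ℕ} → (ℕ → ℕ → ℤ) → Matching m → ℤ
edgeSum t M = sum (λ i → t (toℕ i) (toℕ (p M i)))

oddOpening : ℕ → ℕ → ℤ
oddOpening x y = when (x <ᵇ y) (odd x)

-- An `edgeSum` meets each edge at both of its points. At the larger one `y ∸ x` is truncated to 0
-- and the test fails, so a long edge contributes only once, with the sign of its smaller endpoint.
longSign : ℕ → ℕ → ℕ → ℤ
longSign m x y = when (m <ᵇ (y ∸ x)) (σ x)

oddOpenings : {m : ℕ} → Matching m → ℤ
oddOpenings = edgeSum oddOpening

longSigns : {m : ℕ} → Matching m → ℤ
longSigns {m} = edgeSum (longSign m)

-- If s opens the last long edge, the long edges are those {i < p i} with i ≤ s < p i; in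
-- Σ_{i ≤ s} σ i all other points cancel in pairs.
longSigns-01 : ∀ {m} (M : Matching m) → longSigns M ≡ 0ℤ ⊎ longSigns M ≡ 1ℤ
longSigns-01 {m} M with last-true (λ i → m <ᵇ (toℕ (p M i) ∸ toℕ i))
... | inj₁ none = inj₁ (sum-zero _ (λ i → when-false (none i)))
... | inj₂ (s , s-long , later) = subst (λ z → z ≡ 0ℤ ⊎ z ≡ 1ℤ) (sym total) (odd-01 (suc x))
  where
  open ≡-Reasoning
  x = toℕ s
  y = toℕ (p M s)
  m<y∸x : m < y ∸ x
  m<y∸x = <ᵇ-true⁻¹ s-long
  x+m<y : x ℕ.+ m < y
  x+m<y = <-∸⇒+-< x m<y∸x
  x<m : x < m
  -- From x + m < y < 2m. Hence an edge with both ends at most x is too short to be long.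
  x<m = ℕ.+-cancelʳ-< m x m (ℕ.<-trans x+m<y (subst (y <_) (cong (m ℕ.+_) (ℕ.+-identityʳ m)) (toℕ<n (p M s))))
  below : Fin (2 ℕ.* m) → ℤ
  below i = when (toℕ i <ᵇ suc x) (σ (toℕ i))
  inside : Fin (2 ℕ.* m) → ℤ
  inside i = when (toℕ i <ᵇ suc x) (when (toℕ (p M i) <ᵇ suc x) (σ (toℕ i)))
  crossing : ∀ i → toℕ i ≤ x → x < toℕ (p M i) → y ∸ x ≤ toℕ (p M i) ∸ toℕ i
  -- By `nonCross`, an edge that starts at or before `s` and ends after it encloses the edge of `s`
  -- or equals it, so it is long as well.
  crossing i i≤x x<pi with ℕ.m≤n⇒m<n∨m≡n i≤x
  ... | inj₁ i<x = ℕ.∸-mono (ℕ.<⇒≤ (proj₂ (nonCross M i s i<x x<pi))) i≤x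
  ... | inj₂ i≡x with toℕ-injective i≡x
  ...   | refl = ℕ.≤-refl
  pointwise : ∀ i → longSign m (toℕ i) (toℕ (p M i)) ≡ below i - inside i
  pointwise i with <ᵇ-view (toℕ i) (suc x)
  ... | inj₂ (x<i , eq) rewrite eq = when-false (later i x<i)
  ... | inj₁ (s≤s i≤x , eq) rewrite eq with <ᵇ-view (toℕ (p M i)) (suc x)
  ...   | inj₁ (s≤s pi≤x , eq′) rewrite eq′ =
          trans (when-false (<ᵇ-false (ℕ.≤-trans (ℕ.m∸n≤m (toℕ (p M i)) (toℕ i)) (ℕ.≤-trans pi≤x (ℕ.<⇒≤ x<m)))))
                (sym (ℤ.+-inverseʳ (σ (toℕ i))))
  ...   | inj₂ (x<pi , eq′) rewrite eq′ =
          trans (when-true (<ᵇ-true (ℕ.<-≤-trans m<y∸x (crossing i i≤x x<pi))))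
                (sym (ℤ.+-identityʳ (σ (toℕ i))))
  inside-p : ∀ i → inside i + inside (p M i) ≡ 0ℤ
  inside-p i rewrite invol M i | σ-p M i with toℕ i <ᵇ suc x | toℕ (p M i) <ᵇ suc x
  ... | false | false = refl
  ... | false | true  = refl
  ... | true  | false = refl
  ... | true  | true  = ℤ.+-inverseʳ (σ (toℕ i))
  total : longSigns M ≡ odd (suc x)
  total = begin
    longSigns M                      ≡⟨ sum-cong-≗ pointwise ⟩
    sum (λ i → below i - inside i)   ≡⟨ sum-minus below inside ⟩
    sum below - sum inside           ≡⟨ cong (λ z → sum below - z) (trans (sum-pairs M inside) (sum-zero _ (λ i → trans (cong (when (opens M i)) (inside-p i)) (when-0 (opens M i))))) ⟩
    sum below - 0ℤ                   ≡⟨ ℤ.+-identityʳ (sum below) ⟩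
    sum below                        ≡⟨ sum-below (suc x) σ (toℕ<n s) ⟩
    Σ< (suc x) σ                     ≡⟨ Σ<-σ (suc x) ⟩
    odd (suc x)                      ∎

-- Length and signed length of a single edge.

σ-% : ∀ n → (n ℕ.% 2 ≡ 0 × σ n ≡ 1ℤ) ⊎ (n ℕ.% 2 ≡ 1 × σ n ≡ -1ℤ)
σ-% zero          = inj₁ (refl , refl)
σ-% (suc zero)    = inj₂ (refl , refl)
σ-% (suc (suc n)) = σ-% n

signedLen-σ : ∀ m x y → signedLen m x y ≡ σ (tailIdx m x y) * + len m x y
signedLen-σ m x y with tailIdx m x y ℕ.% 2 | σ-% (tailIdx m x y)
... | .0 | inj₁ (refl , eq) rewrite eq = sym (ℤ.*-identityˡ _)
... | .1 | inj₂ (refl , eq) rewrite eq = sym (ℤ.-1*i≡-i (+ len m x y))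

len-comm : ∀ m x y → len m x y ≡ len m y x
len-comm m x y = cong (λ d → (ℕ._⊓_ d (2 ℕ.* m ∸ d) ∸ 1) ℕ./ 2) (ℕ.∣-∣-comm (toℕ x) (toℕ y))

-- An edge is described by its half-span `k`, with y - x = 2k + 1. As m = 2h is even, the odd span
-- never equals m, so `k < h` and `h ≤ k` are exactly the short and the long case, with lengths k
-- and m - 1 - k.
module _ {m h : ℕ} (m≡h*2 : m ≡ h ℕ.* 2) (x y : Fin (2 ℕ.* m)) (k : ℕ)
         (y≡ : toℕ y ≡ suc (k ℕ.* 2 ℕ.+ toℕ x)) where

  private
    dist : toℕ y ∸ toℕ x ≡ suc (k ℕ.* 2)
    dist = trans (cong (_∸ toℕ x) y≡) (ℕ.m+n∸n≡m (suc (k ℕ.* 2)) (toℕ x))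

    x<y : toℕ x < toℕ y
    x<y = subst (toℕ x <_) (sym y≡) (s≤s (ℕ.m≤n+m (toℕ x) (k ℕ.* 2)))

    len-dist : len m x y ≡ (ℕ._⊓_ (suc (k ℕ.* 2)) (2 ℕ.* m ∸ suc (k ℕ.* 2)) ∸ 1) ℕ./ 2
    len-dist = cong (λ d → (ℕ._⊓_ d (2 ℕ.* m ∸ d) ∸ 1) ℕ./ 2) (trans (ℕ.m≤n⇒∣m-n∣≡n∸m (ℕ.<⇒≤ x<y)) dist)

    2m≡m+m : 2 ℕ.* m ≡ m ℕ.+ m
    2m≡m+m = cong (m ℕ.+_) (ℕ.+-identityʳ m)

    dist<2m : suc (k ℕ.* 2) < 2 ℕ.* m
    dist<2m = ℕ.≤-<-trans (ℕ.≤-trans (ℕ.m≤m+n _ (toℕ x)) (ℕ.≤-reflexive (sym y≡))) (toℕ<n y)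

    k<m : k < m
    k<m = ℕ.*-cancelʳ-< 2 k m (ℕ.<-trans (ℕ.n<1+n _) (subst (suc (k ℕ.* 2) <_) (ℕ.*-comm 2 m) dist<2m))

    j : ℕ
    j = m ∸ suc k

    j+k : j ℕ.+ suc k ≡ m
    j+k = ℕ.m∸n+n≡m k<m

    codist : 2 ℕ.* m ∸ suc (k ℕ.* 2) ≡ suc (j ℕ.* 2)
    codist = trans (cong (_∸ suc (k ℕ.* 2)) (trans (cong (2 ℕ.*_) (sym j+k)) (expand j k))) (ℕ.m+n∸n≡m (suc (j ℕ.* 2)) (suc (k ℕ.* 2)))
      where
      expand : ∀ j k → 2 ℕ.* (j ℕ.+ suc k) ≡ suc (j ℕ.* 2) ℕ.+ suc (k ℕ.* 2)
      expand = solveℕ-∀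

  module _ (k<h : k < h) where

    private
      dist<m : suc (k ℕ.* 2) < m
      dist<m = subst (suc (k ℕ.* 2) <_) (sym m≡h*2) (ℕ.*-monoˡ-≤ 2 k<h)

    short-len : len m x y ≡ k
    short-len = trans len-dist (trans (cong (λ d → (d ∸ 1) ℕ./ 2) (ℕ.m≤n⇒m⊓n≡m dist≤)) (ℕ.m*n/n≡m k 2))
      where
      dist≤ : suc (k ℕ.* 2) ≤ 2 ℕ.* m ∸ suc (k ℕ.* 2)
      dist≤ = ℕ.m+n≤o⇒m≤o∸n (suc (k ℕ.* 2)) (subst (suc (k ℕ.* 2) ℕ.+ suc (k ℕ.* 2) ≤_) (sym 2m≡m+m) (ℕ.+-mono-≤ (ℕ.<⇒≤ dist<m) (ℕ.<⇒≤ dist<m)))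

    short-longSign : longSign m (toℕ x) (toℕ y) ≡ 0ℤ
    short-longSign = when-false (<ᵇ-false (ℕ.≤-trans (ℕ.≤-reflexive dist) (ℕ.<⇒≤ dist<m)))

    short-signedLen : signedLen m x y ≡ σ (toℕ x) * + k
    short-signedLen = trans (signedLen-σ m x y) (cong₂ (λ t l → σ t * + l) tail short-len)
      where
      tail : tailIdx m x y ≡ toℕ x
      tail rewrite <ᵇ-true x<y | dist | <ᵇ-true dist<m = refl

  module _ (h≤k : h ≤ k) where

    private
      m<dist : m < suc (k ℕ.* 2)
      m<dist = s≤s (subst (_≤ k ℕ.* 2) (sym m≡h*2) (ℕ.*-monoˡ-≤ 2 h≤k))

    long-len : len m x y ℕ.+ suc k ≡ m
    long-len = trans (cong (ℕ._+ suc k) (trans len-dist (trans (cong (λ d → (d ∸ 1) ℕ./ 2) (trans (ℕ.m≥n⇒m⊓n≡n codist≤) codist)) (ℕ.m*n/n≡m j 2)))) j+k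
      where
      codist≤ : 2 ℕ.* m ∸ suc (k ℕ.* 2) ≤ suc (k ℕ.* 2)
      codist≤ = ℕ.m≤n+o⇒m∸n≤o (2 ℕ.* m) (suc (k ℕ.* 2)) (subst (_≤ suc (k ℕ.* 2) ℕ.+ suc (k ℕ.* 2)) (sym 2m≡m+m) (ℕ.+-mono-≤ (ℕ.<⇒≤ m<dist) (ℕ.<⇒≤ m<dist)))

    long-longSign : longSign m (toℕ x) (toℕ y) ≡ σ (toℕ x)
    long-longSign = when-true (<ᵇ-true (subst (m <_) (sym dist) m<dist))

    long-signedLen : signedLen m x y ≡ - σ (toℕ x) * + len m x y
    long-signedLen = trans (signedLen-σ m x y) (cong (λ s → s * + len m x y) (trans (cong σ tail) σy))
      where
      tail : tailIdx m x y ≡ toℕ y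
      tail rewrite <ᵇ-true x<y | dist | <ᵇ-false (ℕ.<⇒≤ m<dist) = refl
      σy : σ (toℕ y) ≡ - σ (toℕ x)
      σy = trans (cong σ y≡) (trans (σ-suc (k ℕ.* 2 ℕ.+ toℕ x)) (cong -_ (σ-even+ k (toℕ x))))

  -- The length is the minimum of k and m - 1 - k. This bound and `len+≤` hold in both cases, so
  -- they are available before it is known which edges of a flip are long.
  len≤ : len m x y ≤ k
  len≤ with ℕ.<-≤-connex k h
  ... | inj₁ k<h = ℕ.≤-reflexive (short-len k<h)
  ... | inj₂ h≤k = ℕ.+-cancelʳ-≤ (suc k) (len m x y) k (begin
    len m x y ℕ.+ suc k  ≡⟨ long-len h≤k ⟩
    m                    ≡⟨ m≡h*2 ⟩
    h ℕ.* 2              ≤⟨ ℕ.*-monoˡ-≤ 2 h≤k ⟩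
    k ℕ.* 2              ≤⟨ ℕ.n≤1+n _ ⟩
    suc (k ℕ.* 2)        ≡⟨ twice k ⟩
    k ℕ.+ suc k          ∎)
    where
    open ℕ.≤-Reasoning
    twice : ∀ k → suc (k ℕ.* 2) ≡ k ℕ.+ suc k
    twice = solveℕ-∀

  len+≤ : len m x y ℕ.+ suc k ≤ m
  len+≤ with ℕ.<-≤-connex k h
  ... | inj₂ h≤k = ℕ.≤-reflexive (long-len h≤k)
  ... | inj₁ k<h = begin
    len m x y ℕ.+ suc k  ≡⟨ cong (ℕ._+ suc k) (short-len k<h) ⟩
    k ℕ.+ suc k          ≡⟨ twice k ⟩
    suc (k ℕ.* 2)        ≤⟨ ℕ.n≤1+n _ ⟩
    suc k ℕ.* 2          ≤⟨ ℕ.*-monoˡ-≤ 2 k<h ⟩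
    h ℕ.* 2              ≡⟨ m≡h*2 ⟨
    m                    ∎
    where
    open ℕ.≤-Reasoning
    twice : ∀ k → k ℕ.+ suc k ≡ suc (k ℕ.* 2)
    twice = solveℕ-∀

  -- Doubling clears the halves: 2 k σ x = σ x (y - x - 1), and σ y = - σ x gives it the displayed
  -- form. Its first part is symmetric in the two endpoints, so that over all edges it becomes a sum
  -- over all points.
  twice-signedLen : + 2 * signedLen m x y ≡
    (- (σ (toℕ x) * + toℕ x + σ (toℕ y) * + toℕ y) - σ (toℕ x)) - + 2 * (+ m - 1ℤ) * longSign m (toℕ x) (toℕ y)
  twice-signedLen = trans (lhs (ℕ.<-≤-connex k h)) (cong (λ z → z - + 2 * (+ m - 1ℤ) * longSign m (toℕ x) (toℕ y)) (sym rhs))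
    where
    s = σ (toℕ x)
    σy : σ (toℕ y) ≡ - s
    σy = trans (cong σ y≡) (trans (σ-suc (k ℕ.* 2 ℕ.+ toℕ x)) (cong -_ (σ-even+ k (toℕ x))))
    y≡ℤ : + toℕ y ≡ 1ℤ + (+ k * + 2 + + toℕ x)
    y≡ℤ = trans (cong +_ y≡) (cong (λ z → 1ℤ + (z + + toℕ x)) (ℤ.pos-* k 2))
    rhs : - (s * + toℕ x + σ (toℕ y) * + toℕ y) - s ≡ + 2 * (s * + k)
    rhs = trans (cong₂ (λ t z → - (s * + toℕ x + t * z) - s) σy y≡ℤ) (ring s (+ toℕ x) (+ k))
      where
      ring : ∀ s x k → - (s * x + - s * (1ℤ + (k * + 2 + x))) - s ≡ + 2 * (s * k)
      ring = solve-∀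
    lhs : k < h ⊎ h ≤ k → + 2 * signedLen m x y ≡ + 2 * (s * + k) - + 2 * (+ m - 1ℤ) * longSign m (toℕ x) (toℕ y)
    lhs (inj₁ k<h) rewrite short-signedLen k<h | short-longSign k<h = ring (+ 2 * (s * + k)) (+ 2 * (+ m - 1ℤ))
      where
      ring : ∀ a b → a ≡ a - b * 0ℤ
      ring = solve-∀
    lhs (inj₂ h≤k) rewrite long-signedLen h≤k | long-longSign h≤k =
      trans (ring s (+ len m x y) (+ k)) (cong (λ z → + 2 * (s * + k) - + 2 * (z - 1ℤ) * s) (cong +_ (long-len h≤k)))
      where
      ring : ∀ s l k → + 2 * (- s * l) ≡ + 2 * (s * k) - + 2 * ((l + (1ℤ + k)) - 1ℤ) * s
      ring = solve-∀

-- The weight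

evenOpening : ℕ → ℕ → ℤ
evenOpening x y = when (x <ᵇ y) (odd (suc x))

module _ {m : ℕ} (M : Matching m) where

  odd-p : ∀ i → toℕ i < toℕ (p M i) → odd (toℕ (p M i)) ≡ odd (suc (toℕ i))
  odd-p i i<pi with edge-odd M i i<pi
  ... | k , eq = trans (cong odd (trans eq (sym (ℕ.+-suc (k ℕ.* 2) (toℕ i))))) (odd-even+ k (suc (toℕ i)))

  -- Each edge has exactly one odd end, by `odd-p`, and m of the 2m points are odd.
  odd+even-openings : oddOpenings M + edgeSum evenOpening M ≡ + m
  odd+even-openings = begin
    oddOpenings M + edgeSum evenOpening M
      ≡⟨ ∑-distrib-+ (λ i → oddOpening (toℕ i) (toℕ (p M i))) (λ i → evenOpening (toℕ i) (toℕ (p M i))) ⟨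
    sum (λ i → oddOpening (toℕ i) (toℕ (p M i)) + evenOpening (toℕ i) (toℕ (p M i)))
      ≡⟨ sum-cong-≗ pair ⟨
    sum (λ i → when (opens M i) (odd (toℕ i) + odd (toℕ (p M i))))
      ≡⟨ sum-pairs M (odd ∘ toℕ) ⟨
    sum {2 ℕ.* m} (odd ∘ toℕ)
      ≡⟨ sum-toℕ (2 ℕ.* m) odd ⟩
    Σ< (2 ℕ.* m) odd
      ≡⟨ cong (λ t → Σ< t odd) (ℕ.*-comm 2 m) ⟩
    Σ< (m ℕ.* 2) odd
      ≡⟨ Σ<-odd m ⟩
    + m ∎
    where
    open ≡-Reasoning
    pair : ∀ i → when (opens M i) (odd (toℕ i) + odd (toℕ (p M i))) ≡ oddOpening (toℕ i) (toℕ (p M i)) + evenOpening (toℕ i) (toℕ (p M i))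
    pair i with <ᵇ-view (toℕ i) (toℕ (p M i))
    ... | inj₁ (i<pi , eq) rewrite eq = cong (_+_ (odd (toℕ i))) (odd-p i i<pi)
    ... | inj₂ (_ , eq) rewrite eq = refl

  0≤oddOpenings : 0ℤ ℤ.≤ oddOpenings M
  0≤oddOpenings = sum-nonNeg (λ i → oddOpening (toℕ i) (toℕ (p M i))) nonNeg
    where
    nonNeg : ∀ i → 0ℤ ℤ.≤ oddOpening (toℕ i) (toℕ (p M i))
    nonNeg i with opens M i
    ... | false = ℤ.≤-refl
    ... | true  = 0≤odd (toℕ i)

-- Point 0 always opens an edge and is even, so at most m - 1 of the m edges open at an odd point.
oddOpenings< : ∀ {m} (M : Matching m) → 0 < m → oddOpenings M + 1ℤ ℤ.≤ + m
oddOpenings< {m@(suc m′)} M _ = subst (oddOpenings M + 1ℤ ℤ.≤_) (odd+even-openings M) (ℤ.+-monoʳ-≤ (oddOpenings M) 1≤)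
  where
  nonNeg : ∀ i → 0ℤ ℤ.≤ evenOpening (toℕ i) (toℕ (p M i))
  nonNeg i with opens M i
  ... | false = ℤ.≤-refl
  ... | true  = 0≤odd (suc (toℕ i))
  first : evenOpening 0 (toℕ (p M zero)) ≡ 1ℤ
  first = when-true (<ᵇ-true (ℕ.n≢0⇒n>0 (λ eq → p-≢ M zero (sym eq))))
  1≤ : 1ℤ ℤ.≤ edgeSum evenOpening M
  1≤ = subst (ℤ._≤ edgeSum evenOpening M) first (sum-≥-head (λ i → evenOpening (toℕ i) (toℕ (p M i))) nonNeg zero refl)

-- Sums `twice-signedLen` over the edges. With o odd and e even openings, the endpoint terms `A` add
-- up to m = o + e and the signs `B` to e - o, which leaves 2o; the terms `C` carry the long edges.
weight-formula : ∀ {m h} → m ≡ h ℕ.* 2 → (M : Matching m) →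
                 weight M ≡ oddOpenings M - (+ m - 1ℤ) * longSigns M
weight-formula {m} {h} m≡h*2 M = ℤ.*-cancelˡ-≡ (+ 2) _ _ (begin
  + 2 * weight M
    ≡⟨ cong (_*_ (+ 2)) (foldr-allFin (λ i → when (opens M i) (signedLen m i (p M i)))) ⟩
  + 2 * sum (λ i → when (opens M i) (signedLen m i (p M i)))
    ≡⟨ *-distribˡ-sum (+ 2) (λ i → when (opens M i) (signedLen m i (p M i))) ⟩
  sum (λ i → + 2 * when (opens M i) (signedLen m i (p M i)))
    ≡⟨ sum-cong-≗ pointwise ⟩
  sum (λ i → (A i - B i) - C i)
    ≡⟨ sum-minus (λ i → A i - B i) C ⟩
  sum (λ i → A i - B i) - sum C
    ≡⟨ cong₂ _-_ (sum-minus A B) (sym (*-distribˡ-sum (+ 2 * (+ m - 1ℤ)) L)) ⟩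
  (sum A - sum B) - + 2 * (+ m - 1ℤ) * longSigns M
    ≡⟨ cong (λ z → z - + 2 * (+ m - 1ℤ) * longSigns M) (cong₂ _-_ ΣA ΣB) ⟩
  (+ m - (edgeSum evenOpening M - oddOpenings M)) - + 2 * (+ m - 1ℤ) * longSigns M
    ≡⟨ cong (λ z → (z - (edgeSum evenOpening M - oddOpenings M)) - + 2 * (+ m - 1ℤ) * longSigns M) (odd+even-openings M) ⟨
  ((oddOpenings M + edgeSum evenOpening M) - (edgeSum evenOpening M - oddOpenings M)) - + 2 * (+ m - 1ℤ) * longSigns M
    ≡⟨ ring (oddOpenings M) (edgeSum evenOpening M) (+ m) (longSigns M) ⟩
  + 2 * (oddOpenings M - (+ m - 1ℤ) * longSigns M) ∎)
  where
  open ≡-Reasoning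
  P : Fin (2 ℕ.* m) → ℤ
  P i = σ (toℕ i) * + toℕ i
  A B C L : Fin (2 ℕ.* m) → ℤ
  A i = - when (opens M i) (P i + P (p M i))
  B i = when (opens M i) (σ (toℕ i))
  L i = longSign m (toℕ i) (toℕ (p M i))
  C i = + 2 * (+ m - 1ℤ) * L i
  pointwise : ∀ i → + 2 * when (opens M i) (signedLen m i (p M i)) ≡ (A i - B i) - C i
  pointwise i with <ᵇ-view (toℕ i) (toℕ (p M i))
  ... | inj₁ (i<pi , eq) = opened eq (twice-signedLen {m} {h} m≡h*2 i (p M i) (proj₁ (edge-odd M i i<pi)) (proj₂ (edge-odd M i i<pi)))
    where
    opened : ∀ {b s a t c} → b ≡ true → + 2 * s ≡ (- a - t) - c → + 2 * when b s ≡ (- when b a - when b t) - c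
    opened refl eq = eq
  ... | inj₂ (pi≤i , eq) = closed eq (cong (λ d → when (m <ᵇ d) (σ (toℕ i))) (ℕ.m≤n⇒m∸n≡0 pi≤i))
    where
    vanish : ∀ a → 0ℤ ≡ 0ℤ - a * 0ℤ
    vanish = solve-∀
    closed : ∀ {b s a t l} → b ≡ false → l ≡ 0ℤ → + 2 * when b s ≡ (- when b a - when b t) - + 2 * (+ m - 1ℤ) * l
    closed refl refl = vanish (+ 2 * (+ m - 1ℤ))
  ΣA : sum A ≡ + m
  ΣA = begin
    sum A                                                ≡⟨ sum-neg (λ i → when (opens M i) (P i + P (p M i))) ⟩
    - sum (λ i → when (opens M i) (P i + P (p M i)))     ≡⟨ cong -_ (sum-pairs M P) ⟨
    - sum P                                              ≡⟨ cong -_ (sum-toℕ (2 ℕ.* m) (λ i → σ i * + i)) ⟩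
    - Σ< (2 ℕ.* m) (λ i → σ i * + i)                     ≡⟨ cong (λ t → - Σ< t (λ i → σ i * + i)) (ℕ.*-comm 2 m) ⟩
    - Σ< (m ℕ.* 2) (λ i → σ i * (0ℤ + + i))              ≡⟨ cong -_ (Σ<-σ* m 0ℤ) ⟩
    - (- (+ m))                                          ≡⟨ ℤ.neg-involutive (+ m) ⟩
    + m                                                  ∎
  ΣB : sum B ≡ edgeSum evenOpening M - oddOpenings M
  ΣB = trans (sum-cong-≗ split) (sum-minus (λ i → evenOpening (toℕ i) (toℕ (p M i))) (λ i → oddOpening (toℕ i) (toℕ (p M i))))
    where
    split : ∀ i → B i ≡ evenOpening (toℕ i) (toℕ (p M i)) - oddOpening (toℕ i) (toℕ (p M i))
    split i with opens M i
    ... | false = refl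
    ... | true  = σ≡odd-suc-odd (toℕ i)
  ring : ∀ o e m l → ((o + e) - (e - o)) - + 2 * (m - 1ℤ) * l ≡ + 2 * (o - (m - 1ℤ) * l)
  ring = solve-∀

-- Flips

module _ {m : ℕ} {M M′ : Matching m} {a b c d : Fin (2 ℕ.* m)} (F : Flip M M′ a b c d) where
  open Flip F

  ba : p M b ≡ a
  ba = trans (cong (p M) (sym ab)) (invol M a)

  dc : p M d ≡ c
  dc = trans (cong (p M) (sym cd)) (invol M c)

  ca : p M′ c ≡ a
  ca = trans (cong (p M′) (sym ac)) (invol M′ a)

  db : p M′ d ≡ b
  db = trans (cong (p M′) (sym bd)) (invol M′ b)

  a≢b : a ≢ b
  a≢b a≡b = noFix M a (trans ab (sym a≡b))

  c≢d : c ≢ d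
  c≢d c≡d = noFix M c (trans cd (sym c≡d))

  b≢c : b ≢ c
  b≢c b≡c = a≢d (trans (sym ba) (trans (cong (p M) b≡c) cd))

  b≢d : b ≢ d
  b≢d b≡d = a≢c (trans (sym ba) (trans (cong (p M) b≡d) dc))

  -- This symmetry, `flip-edges` and `flip-inverse` together reduce every flip to the order a < b <
  -- d < c.
  flip-ends : Flip M M′ b a d c
  flip-ends = record
    { ab = ba ; cd = dc ; a≢c = b≢d ; a≢d = b≢c ; ac = bd ; bd = ac
    ; other = λ x x≢b x≢a x≢d x≢c → other x x≢a x≢b x≢c x≢d }

  flip-edges : Flip M M′ c d a b
  flip-edges = record
    { ab = cd ; cd = ab ; a≢c = a≢c ∘ sym ; a≢d = b≢c ∘ sym ; ac = ca ; bd = db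
    ; other = λ x x≢c x≢d x≢a x≢b → other x x≢a x≢b x≢c x≢d }

  flip-inverse : Flip M′ M a c b d
  flip-inverse = record
    { ab = ac ; cd = bd ; a≢c = a≢b ; a≢d = a≢d ; ac = ab ; bd = cd
    ; other = λ x x≢a x≢c x≢b x≢d → sym (other x x≢a x≢b x≢c x≢d) }

  -- Only the four points of the flip change partner, so all other summands cancel. Stating it for
  -- arbitrary `t` covers N and κ at once.
  flip-edgeSum : (t : ℕ → ℕ → ℤ) → let e = λ u v → t (toℕ u) (toℕ v) in
    edgeSum t M - edgeSum t M′ ≡
    (e a b - e a c) + ((e b a - e b d) + ((e c d - e c a) + (e d c - e d b)))
  flip-edgeSum t = begin
    edgeSum t M - edgeSum t M′   ≡⟨ sum-minus (λ i → e i (p M i)) (λ i → e i (p M′ i)) ⟨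
    sum diff                     ≡⟨ sum-support₄ diff a≢b a≢c a≢d b≢c b≢d c≢d vanish ⟩
    diff a + (diff b + (diff c + diff d))
      ≡⟨ cong₂ _+_ (at ab ac) (cong₂ _+_ (at ba bd) (cong₂ _+_ (at cd ca) (at dc db))) ⟩
    (e a b - e a c) + ((e b a - e b d) + ((e c d - e c a) + (e d c - e d b))) ∎
    where
    open ≡-Reasoning
    e : Fin (2 ℕ.* m) → Fin (2 ℕ.* m) → ℤ
    e u v = t (toℕ u) (toℕ v)
    diff : Fin (2 ℕ.* m) → ℤ
    diff i = e i (p M i) - e i (p M′ i)
    at : ∀ {x u v} → p M x ≡ u → p M′ x ≡ v → diff x ≡ e x u - e x v
    at {x} px p′x = cong₂ (λ u v → e x u - e x v) px p′x
    vanish : ∀ x → x ≢ a → x ≢ b → x ≢ c → x ≢ d → diff x ≡ 0ℤ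
    vanish x x≢a x≢b x≢c x≢d = trans (cong (λ v → e x (p M x) - e x v) (other x x≢a x≢b x≢c x≢d)) (ℤ.+-inverseʳ (e x (p M x)))

-- The c with M in 𝓜⁺_{m,c} that is constant on components.  The weight does not determine
-- it, because 𝓜⁺_{m,0} and 𝓜⁺_{m,m-2} share the weight 0.
classIndex : {m : ℕ} → Matching m → ℤ
classIndex M = oddOpenings M - longSigns M

-- The second component is what bounds the class index: the end with κ = 0 gives the lower bound N ≥
-- 0, the end with κ = 1 the upper bound N - 1 ≤ m - 2.
Linked : {m : ℕ} → Matching m → Matching m → Set
Linked M M′ = classIndex M ≡ classIndex M′ × longSigns M ≢ longSigns M′

Linked-sym : ∀ {m} {M M′ : Matching m} → Linked M M′ → Linked M′ M
Linked-sym (eq , neq) = sym eq , neq ∘ sym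

σ≢0 : ∀ n → σ n ≢ 0ℤ
σ≢0 (suc (suc n)) = σ≢0 n

oddOpening-< : ∀ {x y} → x < y → oddOpening x y ≡ odd x
oddOpening-< x<y = when-true (<ᵇ-true x<y)

oddOpening-> : ∀ {x y} → y < x → oddOpening x y ≡ 0ℤ
oddOpening-> y<x = when-false (<ᵇ-false (ℕ.<⇒≤ y<x))

longSign-> : ∀ m {x y} → y < x → longSign m x y ≡ 0ℤ
longSign-> m {x} y<x = cong (λ d → when (m <ᵇ d) (σ x)) (ℕ.m≤n⇒m∸n≡0 (ℕ.<⇒≤ y<x))

-- The effect of a centered flip on N and κ.

Centered : (m : ℕ) (a b c d : Fin (2 ℕ.* m)) → Set
Centered m a b c d = len m a b ℕ.+ len m c d ℕ.+ len m a c ℕ.+ len m b d ≡ m ∸ 2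

spans-regroup : (i j k a : ℕ) → ℕ.suc (k ℕ.* 2 ℕ.+ ℕ.suc (j ℕ.* 2 ℕ.+ ℕ.suc (i ℕ.* 2 ℕ.+ a))) ≡ ℕ.suc (ℕ.suc (i ℕ.+ j ℕ.+ k) ℕ.* 2 ℕ.+ a)
spans-regroup = solveℕ-∀

-- The odd spans 2i + 1, 2j + 1, 2k + 1 of consecutive sides add up to the span 2l + 1 of the outer
-- side.
spans-add : (i j k l : ℕ) {a b c d : ℕ} → b ≡ suc (i ℕ.* 2 ℕ.+ a) → d ≡ suc (j ℕ.* 2 ℕ.+ b) →
            c ≡ suc (k ℕ.* 2 ℕ.+ d) → c ≡ suc (l ℕ.* 2 ℕ.+ a) → l ≡ suc (i ℕ.+ j ℕ.+ k)
spans-add i j k l {a} refl refl refl c≡ = ℕ.*-cancelʳ-≡ l (suc (i ℕ.+ j ℕ.+ k)) 2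
  (ℕ.+-cancelʳ-≡ a _ _ (ℕ.suc-injective (trans (sym c≡) (spans-regroup i j k a))))

-- In the next two lemmas u, v, w are the half-spans of three consecutive sides of
-- the quadrilateral, suc (u + v + w) that of the fourth, and U, V, W, L the lengths.
side-short : ∀ {m h} u v w U V W L → m ≡ h ℕ.* 2 → U ℕ.+ V ℕ.+ W ℕ.+ L ℕ.+ 2 ≡ m →
             U ℕ.+ suc u ≤ m → V ≤ v → W ≤ w → L ℕ.+ suc (suc (u ℕ.+ v ℕ.+ w)) ≤ m → u < h
side-short {m} {h} u v w U V W L m≡h*2 total U≤ V≤ W≤ L≤ = ℕ.*-cancelʳ-< 2 u h (subst (u ℕ.* 2 <_) m≡h*2
  -- Adding the four length bounds and using that the lengths sum to m - 2 leaves 2u + 1 ≤ m, that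
  -- is, u < h.
  (ℕ.+-cancelˡ-≤ (m ℕ.+ (v ℕ.+ w)) (suc (u ℕ.* 2)) m (begin
    m ℕ.+ (v ℕ.+ w) ℕ.+ suc (u ℕ.* 2)
      ≡⟨ cong (λ z → z ℕ.+ (v ℕ.+ w) ℕ.+ suc (u ℕ.* 2)) total ⟨
    U ℕ.+ V ℕ.+ W ℕ.+ L ℕ.+ 2 ℕ.+ (v ℕ.+ w) ℕ.+ suc (u ℕ.* 2)
      ≡⟨ regroup u v w U V W L ⟩
    (U ℕ.+ suc u) ℕ.+ (V ℕ.+ W) ℕ.+ (L ℕ.+ suc (suc (u ℕ.+ v ℕ.+ w)))
      ≤⟨ ℕ.+-mono-≤ (ℕ.+-mono-≤ U≤ (ℕ.+-mono-≤ V≤ W≤)) L≤ ⟩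
    m ℕ.+ (v ℕ.+ w) ℕ.+ m ∎)))
  where
  open ℕ.≤-Reasoning
  regroup : (u v w U V W L : ℕ) → U ℕ.+ V ℕ.+ W ℕ.+ L ℕ.+ 2 ℕ.+ (v ℕ.+ w) ℕ.+ ℕ.suc (u ℕ.* 2) ≡ (U ℕ.+ ℕ.suc u) ℕ.+ (V ℕ.+ W) ℕ.+ (L ℕ.+ ℕ.suc (ℕ.suc (u ℕ.+ v ℕ.+ w)))
  regroup = solveℕ-∀

outer-long : ∀ {m h} u v w U V W L → m ≡ h ℕ.* 2 → U ℕ.+ V ℕ.+ W ℕ.+ L ℕ.+ 2 ≡ m →
             U ≤ u → V ≤ v → W ≤ w → L ≤ suc (u ℕ.+ v ℕ.+ w) → h ≤ suc (u ℕ.+ v ℕ.+ w)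
outer-long {m} {h} u v w U V W L m≡h*2 total U≤ V≤ W≤ L≤ = ℕ.≤-pred (ℕ.*-cancelʳ-< 2 h _ (s≤s (begin
  -- Bounding each length by its half-span gives 2h ≤ 2l + 1 for l = u + v + w + 1, so h ≤ l by
  -- parity.
  h ℕ.* 2                                          ≡⟨ m≡h*2 ⟨
  m                                                ≡⟨ total ⟨
  U ℕ.+ V ℕ.+ W ℕ.+ L ℕ.+ 2                        ≤⟨ ℕ.+-monoˡ-≤ 2 (ℕ.+-mono-≤ (ℕ.+-mono-≤ (ℕ.+-mono-≤ U≤ V≤) W≤) L≤) ⟩
  u ℕ.+ v ℕ.+ w ℕ.+ suc (u ℕ.+ v ℕ.+ w) ℕ.+ 2      ≡⟨ regroup (u ℕ.+ v ℕ.+ w) ⟩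
  suc (suc (u ℕ.+ v ℕ.+ w) ℕ.* 2)                  ∎)))
  where
  open ℕ.≤-Reasoning
  regroup : (t : ℕ) → t ℕ.+ ℕ.suc t ℕ.+ 2 ≡ ℕ.suc (ℕ.suc t ℕ.* 2)
  regroup = solveℕ-∀

rotateˡ : ∀ x y z → z ℕ.+ x ℕ.+ y ≡ x ℕ.+ y ℕ.+ z
rotateˡ = solveℕ-∀

+2-reorder : ∀ x y z w → x ℕ.+ y ℕ.+ z ℕ.+ w ℕ.+ 2 ≡ x ℕ.+ z ℕ.+ w ℕ.+ y ℕ.+ 2
+2-reorder = solveℕ-∀

-- For a < b < d < c, the zeros stand for the terms of `flip-edgeSum` in which an edge is seen from
-- its larger end.
cancel-lower : ∀ ab ac bd dc → (ab - ac) + ((0ℤ - bd) + ((0ℤ - 0ℤ) + (dc - 0ℤ))) ≡ (ab - ac) + (dc - bd)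
cancel-lower = solve-∀

equal-differences : ∀ x x′ y y′ → x - x′ ≡ y - y′ → x - y ≡ x′ - y′
equal-differences x x′ y y′ eq = begin
  x - y                   ≡⟨ expand x x′ y ⟩
  (x - x′) + (x′ - y)     ≡⟨ cong (_+ (x′ - y)) eq ⟩
  (y - y′) + (x′ - y)     ≡⟨ contract x′ y y′ ⟩
  x′ - y′                 ∎
  where
  open ≡-Reasoning
  expand : ∀ x x′ y → x - y ≡ (x - x′) + (x′ - y)
  expand = solve-∀
  contract : ∀ x′ y y′ → (y - y′) + (x′ - y) ≡ x′ - y′
  contract = solve-∀

-- In `M′` the edge {a,c} encloses b and hence its partner d. In `M`, if d lay inside {a,b}, its
-- partner c would too, against b < c.
sorted : ∀ {m} {M M′ : Matching m} {a b c d} → Flip M M′ a b c d →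
         toℕ a < toℕ b → toℕ a < toℕ d → toℕ b < toℕ c → toℕ b < toℕ d × toℕ d < toℕ c
sorted {M = M} {M′} {a} {b} {c} {d} F a<b a<d b<c = b<d , d<c
  where
  open Flip F
  d<c : toℕ d < toℕ c
  d<c = subst₂ (λ u v → toℕ u < toℕ v) bd ac (proj₂ (nonCross M′ a b a<b (subst (λ v → toℕ b < toℕ v) (sym ac) b<c)))
  b<d : toℕ b < toℕ d
  b<d with ℕ.<-cmp (toℕ b) (toℕ d)
  ... | tri< b<d _ _ = b<d
  ... | tri≈ _ b≡d _ = contradiction (toℕ-injective b≡d) (b≢d F)
  ... | tri> _ _ d<b = contradiction
        (subst₂ (λ u v → toℕ u < toℕ v) (dc F) ab (proj₂ (nonCross M a d a<d (subst (λ v → toℕ d < toℕ v) (sym ab) d<b))))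
        (ℕ.<-asym b<c)

+-reorder : ∀ x y z w → x ℕ.+ y ℕ.+ z ℕ.+ w ≡ z ℕ.+ w ℕ.+ x ℕ.+ y
+-reorder = solveℕ-∀

centered-ends : ∀ {m} {a b c d : Fin (2 ℕ.* m)} → Centered m a b c d → Centered m b a d c
centered-ends {m} {a} {b} {c} {d} cent = trans
  (cong₂ (λ x y → x ℕ.+ y ℕ.+ len m b d ℕ.+ len m a c) (len-comm m b a) (len-comm m d c))
  (trans (swap-last (len m a b ℕ.+ len m c d) (len m b d) (len m a c)) cent)
  where
  swap-last : ∀ x y z → x ℕ.+ y ℕ.+ z ≡ x ℕ.+ z ℕ.+ y
  swap-last = solveℕ-∀

centered-edges : ∀ {m} {a b c d : Fin (2 ℕ.* m)} → Centered m a b c d → Centered m c d a b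
centered-edges {m} {a} {b} {c} {d} cent = trans
  (cong₂ (λ x y → len m c d ℕ.+ len m a b ℕ.+ x ℕ.+ y) (len-comm m c a) (len-comm m d b))
  (trans (cong (λ z → z ℕ.+ len m a c ℕ.+ len m b d) (ℕ.+-comm (len m c d) (len m a b))) cent)

centered-inverse : ∀ {m} {a b c d : Fin (2 ℕ.* m)} → Centered m a b c d → Centered m a c b d
centered-inverse {m} {a} {b} {c} {d} cent = trans (+-reorder (len m a c) (len m b d) (len m a b) (len m c d)) cent

module _ {m h : ℕ} (m≡h*2 : m ≡ h ℕ.* 2) (2≤m : 2 ≤ m) where

  flip-linked-sorted : {M M′ : Matching m} {a b c d : Fin (2 ℕ.* m)} → Flip M M′ a b c d →
    Centered m a b c d → toℕ a < toℕ b → toℕ b < toℕ d → toℕ d < toℕ c → Linked M M′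
  flip-linked-sorted {M} {M′} {a} {b} {c} {d} F cent a<b b<d d<c =
    -- The values of κ differ by - σ a, which is nonzero.
    index , λ κ≡κ′ → σ≢0 (toℕ a) (trans (sym (ℤ.neg-involutive s)) (cong -_ (trans (sym Δκ) (trans (cong (_- longSigns M′) κ≡κ′) (ℤ.+-inverseʳ (longSigns M′))))))
    where
    s = σ (toℕ a)
    odd-span : (X : Matching m) {u v : Fin (2 ℕ.* m)} → p X u ≡ v → toℕ u < toℕ v → ∃[ k ] toℕ v ≡ suc (k ℕ.* 2 ℕ.+ toℕ u)
    odd-span X {u} refl u<v = edge-odd X u u<v
    a<d = ℕ.<-trans a<b b<d
    b<c = ℕ.<-trans b<d d<c
    a<c = ℕ.<-trans a<b b<c
    -- {a,b} and {d,c} are edges of `M`, while {b,d} and {a,c} are edges of `M′`; so every side has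
    -- an odd span.
    AB = odd-span M (Flip.ab F) a<b
    BD = odd-span M′ (Flip.bd F) b<d
    DC = odd-span M (dc F) d<c
    AC = odd-span M′ (Flip.ac F) a<c
    i = proj₁ AB
    j = proj₁ BD
    k = proj₁ DC
    l = proj₁ AC
    l≡ : l ≡ suc (i ℕ.+ j ℕ.+ k)
    l≡ = spans-add i j k l (proj₂ AB) (proj₂ BD) (proj₂ DC) (proj₂ AC)
    Lab = len m a b
    Lbd = len m b d
    Ldc = len m d c
    Lac = len m a c
    total : Lab ℕ.+ Lbd ℕ.+ Ldc ℕ.+ Lac ℕ.+ 2 ≡ m
    total = trans (+2-reorder Lab Lbd Ldc Lac) (trans (cong (ℕ._+ 2) (trans (cong (λ z → Lab ℕ.+ z ℕ.+ Lac ℕ.+ Lbd) (len-comm m d c)) cent)) (ℕ.m∸n+n≡m 2≤m))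
    ab≤ = len≤ {m} {h} m≡h*2 a b i (proj₂ AB)
    bd≤ = len≤ {m} {h} m≡h*2 b d j (proj₂ BD)
    dc≤ = len≤ {m} {h} m≡h*2 d c k (proj₂ DC)
    ac≤ = subst (Lac ≤_) l≡ (len≤ {m} {h} m≡h*2 a c l (proj₂ AC))
    ab+≤ = len+≤ {m} {h} m≡h*2 a b i (proj₂ AB)
    bd+≤ = len+≤ {m} {h} m≡h*2 b d j (proj₂ BD)
    dc+≤ = len+≤ {m} {h} m≡h*2 d c k (proj₂ DC)
    ac+≤ = subst (λ z → Lac ℕ.+ suc z ≤ m) l≡ (len+≤ {m} {h} m≡h*2 a c l (proj₂ AC))
    -- Each of the three inner sides takes the first role in `side-short` in turn; the outer side
    -- {a,c} is then long by `outer-long`.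
    i<h : i < h
    i<h = side-short i j k Lab Lbd Ldc Lac m≡h*2 total ab+≤ bd≤ dc≤ ac+≤
    j<h : j < h
    j<h = side-short j i k Lbd Lab Ldc Lac m≡h*2 (trans (cong (λ z → z ℕ.+ Ldc ℕ.+ Lac ℕ.+ 2) (ℕ.+-comm Lbd Lab)) total) bd+≤ ab≤ dc≤
            (subst (λ z → Lac ℕ.+ suc (suc (z ℕ.+ k)) ≤ m) (ℕ.+-comm i j) ac+≤)
    k<h : k < h
    k<h = side-short k i j Ldc Lab Lbd Lac m≡h*2 (trans (cong (λ z → z ℕ.+ Lac ℕ.+ 2) (rotateˡ Lab Lbd Ldc)) total) dc+≤ ab≤ bd≤
            (subst (λ z → Lac ℕ.+ suc (suc z) ≤ m) (sym (rotateˡ i j k)) ac+≤)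
    h≤l : h ≤ l
    h≤l = subst (h ≤_) (sym l≡) (outer-long i j k Lab Lbd Ldc Lac m≡h*2 total ab≤ bd≤ dc≤ ac≤)
    collect : ∀ {ab ac ba bd cd ca dc db ab′ ac′ bd′ dc′ : ℤ} → ba ≡ 0ℤ → cd ≡ 0ℤ → ca ≡ 0ℤ → db ≡ 0ℤ →
              ab ≡ ab′ → ac ≡ ac′ → bd ≡ bd′ → dc ≡ dc′ →
              (ab - ac) + ((ba - bd) + ((cd - ca) + (dc - db))) ≡ (ab′ - ac′) + (dc′ - bd′)
    collect {ab} {ac} {bd = bd} {dc = dc} refl refl refl refl refl refl refl refl = cancel-lower ab ac bd dc
    Δκ : longSigns M - longSigns M′ ≡ - s
    Δκ = trans (flip-edgeSum F (longSign m)) (trans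
      (collect (longSign-> m a<b) (longSign-> m d<c) (longSign-> m a<c) (longSign-> m b<d)
        (short-longSign {m} {h} m≡h*2 a b i (proj₂ AB) i<h)
        (long-longSign {m} {h} m≡h*2 a c l (proj₂ AC) h≤l)
        (short-longSign {m} {h} m≡h*2 b d j (proj₂ BD) j<h)
        (short-longSign {m} {h} m≡h*2 d c k (proj₂ DC) k<h))
      (trans (ℤ.+-identityʳ (0ℤ - s)) (ℤ.+-identityˡ (- s))))
    -- {a,b} and {a,c} both open at a and cancel in N. What remains is d, opening in `M`, against b,
    -- opening in `M′`; the difference of their parities is σ b = - σ a.
    odd-d : odd (toℕ d) ≡ odd (suc (toℕ b))
    odd-d = trans (cong odd (trans (proj₂ BD) (sym (ℕ.+-suc (j ℕ.* 2) (toℕ b))))) (odd-even+ j (suc (toℕ b)))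
    σb : σ (toℕ b) ≡ - s
    σb = trans (cong σ (proj₂ AB)) (trans (σ-suc (i ℕ.* 2 ℕ.+ toℕ a)) (cong -_ (σ-even+ i (toℕ a))))
    ΔN : oddOpenings M - oddOpenings M′ ≡ - s
    ΔN = trans (flip-edgeSum F oddOpening) (trans
      (collect (oddOpening-> a<b) (oddOpening-> d<c) (oddOpening-> a<c) (oddOpening-> b<d)
        (oddOpening-< a<b) (oddOpening-< a<c) (oddOpening-< b<d) (trans (oddOpening-< d<c) odd-d))
      (trans (cong (_+ (odd (suc (toℕ b)) - odd (toℕ b))) (ℤ.+-inverseʳ (odd (toℕ a))))
        (trans (ℤ.+-identityˡ (odd (suc (toℕ b)) - odd (toℕ b))) (trans (sym (σ≡odd-suc-odd (toℕ b))) σb))))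
    index : classIndex M ≡ classIndex M′
    index = equal-differences (oddOpenings M) (oddOpenings M′) (longSigns M) (longSigns M′) (trans ΔN (sym Δκ))

  -- Once a is the least point, either b < c and the points are in the required order, or c < b and
  -- those of the inverse flip are.
  flip-linked-least : {M M′ : Matching m} {a b c d : Fin (2 ℕ.* m)} → Flip M M′ a b c d →
    Centered m a b c d → toℕ a < toℕ b → toℕ a < toℕ c → toℕ a < toℕ d → Linked M M′
  flip-linked-least {M} {M′} {a} {b} {c} {d} F cent a<b a<c a<d with ℕ.<-cmp (toℕ b) (toℕ c)
  ... | tri< b<c _ _ = let b<d , d<c = sorted F a<b a<d b<c in flip-linked-sorted F cent a<b b<d d<c
  ... | tri≈ _ b≡c _ = contradiction (toℕ-injective b≡c) (b≢c F)
  ... | tri> _ _ c<b = let c<d , d<b = sorted (flip-inverse F) a<c a<d c<b in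
        Linked-sym {M = M′} {M′ = M} (flip-linked-sorted (flip-inverse F) (centered-inverse {m} {a} {b} {c} {d} cent) a<c c<d d<b)

  flip-linked-< : {M M′ : Matching m} {a b c d : Fin (2 ℕ.* m)} → Flip M M′ a b c d →
    Centered m a b c d → toℕ a < toℕ b → Linked M M′
  flip-linked-< {M} {M′} {a} {b} {c} {d} F cent a<b with ℕ.<-cmp (toℕ c) (toℕ d)
  ... | tri≈ _ c≡d _ = contradiction (toℕ-injective c≡d) (c≢d F)
  ... | tri< c<d _ _ with ℕ.<-cmp (toℕ a) (toℕ c)
  ...   | tri< a<c _ _ = flip-linked-least F cent a<b a<c (ℕ.<-trans a<c c<d)
  ...   | tri≈ _ a≡c _ = contradiction (toℕ-injective a≡c) (Flip.a≢c F)
  ...   | tri> _ _ c<a = flip-linked-least (flip-edges F) (centered-edges {m} {a} {b} {c} {d} cent) c<d c<a (ℕ.<-trans c<a a<b)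
  flip-linked-< {M} {M′} {a} {b} {c} {d} F cent a<b | tri> _ _ d<c with ℕ.<-cmp (toℕ a) (toℕ d)
  ...   | tri< a<d _ _ = flip-linked-least F cent a<b (ℕ.<-trans a<d d<c) a<d
  ...   | tri≈ _ a≡d _ = contradiction (toℕ-injective a≡d) (Flip.a≢d F)
  ...   | tri> _ _ d<a = flip-linked-least (flip-ends (flip-edges F))
          (centered-ends {m} {c} {d} {a} {b} (centered-edges {m} {a} {b} {c} {d} cent)) d<c (ℕ.<-trans d<a a<b) d<a

  flip-linked : {M M′ : Matching m} {a b c d : Fin (2 ℕ.* m)} → Flip M M′ a b c d → Centered m a b c d → Linked M M′
  flip-linked {M} {M′} {a} {b} {c} {d} F cent with ℕ.<-cmp (toℕ a) (toℕ b)
  ... | tri≈ _ a≡b _ = contradiction (toℕ-injective a≡b) (a≢b F)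
  ... | tri< a<b _ _ = flip-linked-< F cent a<b
  ... | tri> _ _ b<a = flip-linked-< (flip-ends F) (centered-ends {m} {a} {b} {c} {d} cent) b<a

edgeSum-cong : ∀ {m} (t : ℕ → ℕ → ℤ) {M M′ : Matching m} → SameMatching M M′ → edgeSum t M ≡ edgeSum t M′
edgeSum-cong t same = sum-cong-≗ (λ i → cong (λ v → t (toℕ i) (toℕ v)) (same i))

-- Classes

module _ {m h : ℕ} (m≡h*2 : m ≡ h ℕ.* 2) (2≤m : 2 ≤ m) where

  private
    m∸2≡ : + (m ∸ 2) ≡ + m - + 2
    m∸2≡ = trans (sym (ℤ.⊖-≥ 2≤m)) (sym (ℤ.m-n≡m⊖n m 2))

  -- κ selects the alternative: weight c for κ = 0, and c - (m - 2) for κ = 1.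
  classIndex⇒InClass : ∀ {c} (M : Matching m) → classIndex M ≡ + c → InClass m c M
  classIndex⇒InClass {c} M index with longSigns-01 M
  ... | inj₁ κ≡0 = inj₁ (begin
    weight M                                        ≡⟨ weight-formula {m} {h} m≡h*2 M ⟩
    oddOpenings M - (+ m - 1ℤ) * longSigns M        ≡⟨ cong (λ z → oddOpenings M - (+ m - 1ℤ) * z) κ≡0 ⟩
    oddOpenings M - (+ m - 1ℤ) * 0ℤ                 ≡⟨ cong (λ z → oddOpenings M - z) (ℤ.*-zeroʳ (+ m - 1ℤ)) ⟩
    oddOpenings M - 0ℤ                              ≡⟨ cong (λ z → oddOpenings M - z) κ≡0 ⟨
    classIndex M                                    ≡⟨ index ⟩
    + c                                             ∎)
    where open ≡-Reasoning
  ... | inj₂ κ≡1 = inj₂ (begin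
    weight M                                        ≡⟨ weight-formula {m} {h} m≡h*2 M ⟩
    oddOpenings M - (+ m - 1ℤ) * longSigns M        ≡⟨ cong (λ z → oddOpenings M - (+ m - 1ℤ) * z) κ≡1 ⟩
    oddOpenings M - (+ m - 1ℤ) * 1ℤ                 ≡⟨ regroup (oddOpenings M) (+ m) ⟩
    (oddOpenings M - 1ℤ) - (+ m - + 2)              ≡⟨ cong₂ (λ z w → (oddOpenings M - z) - w) κ≡1 m∸2≡ ⟨
    classIndex M - + (m ∸ 2)                        ≡⟨ cong (λ z → z - + (m ∸ 2)) index ⟩
    + c - + (m ∸ 2)                                 ∎)
    where
    open ≡-Reasoning
    regroup : ∀ n m → n - (m - 1ℤ) * 1ℤ ≡ (n - 1ℤ) - (m - + 2)
    regroup = solve-∀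

  0≤classIndex : (M : Matching m) → longSigns M ≡ 0ℤ → 0ℤ ℤ.≤ classIndex M
  0≤classIndex M κ≡0 = subst (0ℤ ℤ.≤_) (sym (trans (cong (λ z → oddOpenings M - z) κ≡0) (ℤ.+-identityʳ (oddOpenings M)))) (0≤oddOpenings M)

  classIndex≤ : (M : Matching m) → longSigns M ≡ 1ℤ → classIndex M ℤ.≤ + (m ∸ 2)
  classIndex≤ M κ≡1 = subst₂ ℤ._≤_ lhs (sym m∸2≡) (ℤ.+-monoˡ-≤ (- (+ 2)) (oddOpenings< M (ℕ.≤-trans (s≤s z≤n) 2≤m)))
    where
    regroup : ∀ n → (n + 1ℤ) - + 2 ≡ n - 1ℤ
    regroup = solve-∀
    lhs : (oddOpenings M + 1ℤ) - + 2 ≡ classIndex M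
    lhs = trans (regroup (oddOpenings M)) (cong (λ z → oddOpenings M - z) (sym κ≡1))

  linked-bounds : (M M′ : Matching m) → Linked M M′ → 0ℤ ℤ.≤ classIndex M × classIndex M ℤ.≤ + (m ∸ 2)
  linked-bounds M M′ (K≡K′ , κ≢κ′) with longSigns-01 M | longSigns-01 M′
  ... | inj₁ κ≡0 | inj₁ κ′≡0 = contradiction (trans κ≡0 (sym κ′≡0)) κ≢κ′
  ... | inj₁ κ≡0 | inj₂ κ′≡1 = 0≤classIndex M κ≡0 , subst (ℤ._≤ + (m ∸ 2)) (sym K≡K′) (classIndex≤ M′ κ′≡1)
  ... | inj₂ κ≡1 | inj₁ κ′≡0 = subst (0ℤ ℤ.≤_) (sym K≡K′) (0≤classIndex M′ κ′≡0) , classIndex≤ M κ≡1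
  ... | inj₂ κ≡1 | inj₂ κ′≡1 = contradiction (trans κ≡1 (sym κ′≡1)) κ≢κ′

  centeredFlip-linked : {M M′ : Matching m} → CenteredFlip M M′ → Linked M M′
  centeredFlip-linked (a , b , c , d , F , cent) = flip-linked {m} {h} m≡h*2 2≤m F cent

  centeredFlip-InClass : (M M′ : Matching m) → CenteredFlip M M′ →
    ∃[ c ] (c ≤ m ∸ 2 × InClass m c M × InClass m c M′)
  centeredFlip-InClass M M′ fl =
    ℤ.∣ classIndex M ∣ , ℤ.drop‿+≤+ (subst (ℤ._≤ + (m ∸ 2)) (sym +c) (proj₂ bounds)) ,
    classIndex⇒InClass M (sym +c) , classIndex⇒InClass M′ (trans (sym (proj₁ linked)) (sym +c))
    where
    linked : Linked M M′
    linked = centeredFlip-linked fl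
    bounds : 0ℤ ℤ.≤ classIndex M × classIndex M ℤ.≤ + (m ∸ 2)
    bounds = linked-bounds M M′ linked
    +c : + ℤ.∣ classIndex M ∣ ≡ classIndex M
    +c = ℤ.0≤i⇒+∣i∣≡i (proj₁ bounds)

  step-classIndex : {M M′ : Matching m} → Step M M′ → classIndex M ≡ classIndex M′
  step-classIndex (inj₁ fl)        = proj₁ (centeredFlip-linked fl)
  step-classIndex (inj₂ (inj₁ fl)) = sym (proj₁ (centeredFlip-linked fl))
  step-classIndex {M} {M′} (inj₂ (inj₂ same)) = cong₂ _-_ (edgeSum-cong oddOpening {M} {M′} same) (edgeSum-cong (longSign m) {M} {M′} same)

  connected-classIndex : {M M′ : Matching m} → Connected M M′ → classIndex M ≡ classIndex M′
  connected-classIndex ε = refl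
  connected-classIndex (_◅_ {j = M″} step steps) = trans (step-classIndex {M′ = M″} step) (connected-classIndex steps)

-- A matching in each class

-- The involution that exchanges 2r and 2r + 1.
neighbour : ℕ → ℕ
neighbour zero          = 1
neighbour (suc zero)    = 0
neighbour (suc (suc n)) = suc (suc (neighbour n))

neighbour-involutive : ∀ n → neighbour (neighbour n) ≡ n
neighbour-involutive zero          = refl
neighbour-involutive (suc zero)    = refl
neighbour-involutive (suc (suc n)) = cong (2 ℕ.+_) (neighbour-involutive n)

neighbour-view : ∀ n → (neighbour n ≡ suc n × odd n ≡ 0ℤ) ⊎ (suc (neighbour n) ≡ n × odd (suc n) ≡ 0ℤ)
neighbour-view zero       = inj₁ (refl , refl)
neighbour-view (suc zero) = inj₂ (refl , refl)
neighbour-view (suc (suc n)) with neighbour-view n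
... | inj₁ (eq , even) = inj₁ (cong (2 ℕ.+_) eq , even)
... | inj₂ (eq , even) = inj₂ (cong (2 ℕ.+_) eq , even)

neighbour-< : ∀ k {n} → n < k ℕ.* 2 → neighbour n < k ℕ.* 2
neighbour-< (suc k) {zero}        _                = s≤s (s≤s z≤n)
neighbour-< (suc k) {suc zero}    _                = s≤s z≤n
neighbour-< (suc k) {suc (suc n)} (s≤s (s≤s n<2k)) = s≤s (s≤s (neighbour-< k n<2k))

neighbour-≥ : ∀ k {n} → k ℕ.* 2 ≤ n → k ℕ.* 2 ≤ neighbour n
neighbour-≥ zero    _                = z≤n
neighbour-≥ (suc k) (s≤s (s≤s 2k≤n)) = s≤s (s≤s (neighbour-≥ k 2k≤n))

neighbour-tight : ∀ {n j} → n < j → ¬ j < neighbour n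
neighbour-tight {n} {j} n<j j<n′ with neighbour-view n
... | inj₁ (eq , _) = ℕ.<-irrefl refl (ℕ.<-≤-trans j<n′ (ℕ.≤-trans (ℕ.≤-reflexive eq) n<j))
... | inj₂ (eq , _) = ℕ.<-asym n<j (ℕ.<-trans j<n′ (ℕ.≤-reflexive eq))

-- The edge {0, 2k+1} with edges of length 0 on both sides of it.
data Fan (k : ℕ) : ℕ → ℕ → Set where
  root  : Fan k 0 (suc (k ℕ.* 2))
  back  : Fan k (suc (k ℕ.* 2)) 0
  inner : ∀ {j} → j < k ℕ.* 2 → Fan k (suc j) (suc (neighbour j))
  outer : ∀ {i} → suc k ℕ.* 2 ≤ i → Fan k i (neighbour i)

fan : ∀ k i → ∃[ y ] Fan k i y
fan k zero    = suc (k ℕ.* 2) , root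
fan k (suc j) with ℕ.<-cmp j (k ℕ.* 2)
... | tri< j<2k _ _ = suc (neighbour j) , inner j<2k
... | tri≈ _ refl _ = 0 , back
... | tri> _ _ 2k<j = neighbour (suc j) , outer (s≤s 2k<j)

fan-sym : ∀ {k i y} → Fan k i y → Fan k y i
fan-sym root = back
fan-sym back = root
fan-sym {k} (inner {j} j<2k) = subst (λ z → Fan k (suc (neighbour j)) (suc z)) (neighbour-involutive j) (inner (neighbour-< k j<2k))
fan-sym {k} (outer {i} 2k<i) = subst (Fan k (neighbour i)) (neighbour-involutive i) (outer (neighbour-≥ (suc k) 2k<i))

-- The four kinds of points do not overlap. Together with `fan-sym` this makes the partner function
-- an involution.
fan-unique : ∀ {k i y z} → Fan k i y → Fan k i z → y ≡ z
fan-unique root root = refl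
fan-unique root (outer ())
fan-unique back back = refl
fan-unique back (inner 2k<2k) = contradiction 2k<2k (ℕ.<-irrefl refl)
fan-unique back (outer (s≤s 2k<2k)) = contradiction 2k<2k (ℕ.<-irrefl refl)
fan-unique (inner 2k<2k) back = contradiction 2k<2k (ℕ.<-irrefl refl)
fan-unique (inner _) (inner _) = refl
fan-unique (inner j<2k) (outer (s≤s 2k<j)) = contradiction j<2k (ℕ.<-asym 2k<j)
fan-unique (outer ()) root
fan-unique (outer (s≤s 2k<2k)) back = contradiction 2k<2k (ℕ.<-irrefl refl)
fan-unique (outer (s≤s 2k<j)) (inner j<2k) = contradiction j<2k (ℕ.<-asym 2k<j)
fan-unique (outer _) (outer _) = refl

fan-irrefl : ∀ {k i} → ¬ Fan k i i
fan-irrefl f = go f refl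
  where
  n≢neighbour : ∀ n → n ≢ neighbour n
  n≢neighbour (suc (suc n)) eq = n≢neighbour n (ℕ.suc-injective (ℕ.suc-injective eq))
  go : ∀ {k i y} → Fan k i y → i ≢ y
  go (inner {j} _) eq = n≢neighbour j (ℕ.suc-injective eq)
  go (outer {i} _) eq = n≢neighbour i eq

fan-bound : ∀ {k m i y} → k < m → Fan k i y → i < m ℕ.* 2 → y < m ℕ.* 2
fan-bound k<m root _ = ℕ.*-monoˡ-≤ 2 k<m
fan-bound k<m back i<2m = ℕ.≤-trans (s≤s z≤n) i<2m
fan-bound {k} k<m (inner j<2k) _ = ℕ.≤-trans (s≤s (neighbour-< k j<2k)) (ℕ.≤-trans (ℕ.n≤1+n _) (ℕ.*-monoˡ-≤ 2 k<m))
fan-bound {m = m} k<m (outer _) i<2m = neighbour-< m i<2m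

-- Inner and outer edges join adjacent points and so enclose nothing; the root edge encloses exactly
-- the inner ones.
fan-nonCross : ∀ {k i y j z} → Fan k i y → Fan k j z → i < j → j < y → i < z × z < y
fan-nonCross {k} root (inner j<2k) _ _ = s≤s z≤n , s≤s (neighbour-< k j<2k)
fan-nonCross root back _ j<y = contradiction j<y (ℕ.<-irrefl refl)
fan-nonCross root (outer 2k<j) _ j<y = contradiction 2k<j (ℕ.<⇒≱ (ℕ.<-trans j<y (ℕ.n<1+n _)))
fan-nonCross (inner _) g (s≤s i<j) (s≤s j<y) = contradiction j<y (neighbour-tight i<j)
fan-nonCross (outer _) g i<j j<y = contradiction j<y (neighbour-tight i<j)

-- The root and the outer edges open at even points. The inner edges, shifted by one, open at the
-- odd points 1, 3, ..., 2k - 1, so that N = k.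
fan-oddOpening : ∀ {k i y} → Fan k i y → oddOpening i y ≡ when (i <ᵇ suc (k ℕ.* 2)) (odd i)
fan-oddOpening root = refl
fan-oddOpening {k} back = sym (when-false (<ᵇ-false (ℕ.≤-refl {k ℕ.* 2})))
fan-oddOpening {k} (inner {j} j<2k) with neighbour-view j
... | inj₁ (eq , _) = trans (oddOpening-< (s≤s (ℕ.≤-reflexive (sym eq)))) (sym (when-true (<ᵇ-true j<2k)))
... | inj₂ (eq , even) = trans (oddOpening-> (s≤s (ℕ.≤-reflexive eq))) (sym (trans (when-true (<ᵇ-true j<2k)) even))
fan-oddOpening {k} (outer {i} 2k<i) = trans lhs (sym (when-false (<ᵇ-false (ℕ.≤-trans (ℕ.n≤1+n _) 2k<i))))
  where
  lhs : oddOpening i (neighbour i) ≡ 0ℤ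
  lhs with neighbour-view i
  ... | inj₁ (eq , even) = trans (oddOpening-< (ℕ.≤-reflexive (sym eq))) even
  ... | inj₂ (eq , _)    = oddOpening-> (ℕ.≤-reflexive eq)

longSign-near : ∀ {m x y} → 1 ≤ m → y ≤ suc x → longSign m x y ≡ 0ℤ
longSign-near {m} {x} {y} 1≤m y≤1+x = when-false (<ᵇ-false (ℕ.≤-trans (ℕ.m≤n+o⇒m∸n≤o y x (subst (y ≤_) (ℕ.+-comm 1 x) y≤1+x)) 1≤m))

neighbour-≤ : ∀ n → neighbour n ≤ suc n
neighbour-≤ zero          = s≤s z≤n
neighbour-≤ (suc zero)    = z≤n
neighbour-≤ (suc (suc n)) = s≤s (s≤s (neighbour-≤ n))

-- Every edge other than the root has span 1, so κ depends only on whether the root edge, seen from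
-- 0, is long.
fan-longSign : ∀ {k m i y} → 1 ≤ m → i ≢ 0 → Fan k i y → longSign m i y ≡ 0ℤ
fan-longSign 1≤m i≢0 root = contradiction refl i≢0
fan-longSign {k} {m} 1≤m i≢0 back = longSign-near {m} {suc (k ℕ.* 2)} 1≤m z≤n
fan-longSign {m = m} 1≤m i≢0 (inner {j} _) = longSign-near {m} {suc j} 1≤m (s≤s (neighbour-≤ j))
fan-longSign {m = m} 1≤m i≢0 (outer {i} _) = longSign-near {m} {i} 1≤m (neighbour-≤ i)

module _ {m k : ℕ} (k<m : k < m) where

  private
    bound : (i : Fin (2 ℕ.* m)) → proj₁ (fan k (toℕ i)) < 2 ℕ.* m
    bound i = subst (proj₁ (fan k (toℕ i)) <_) (ℕ.*-comm m 2) (fan-bound k<m (proj₂ (fan k (toℕ i))) (subst (toℕ i <_) (ℕ.*-comm 2 m) (toℕ<n i)))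

    partner : Fin (2 ℕ.* m) → Fin (2 ℕ.* m)
    partner i = fromℕ< (bound i)

    partner-fan : ∀ i → Fan k (toℕ i) (toℕ (partner i))
    partner-fan i = subst (Fan k (toℕ i)) (sym (toℕ-fromℕ< (bound i))) (proj₂ (fan k (toℕ i)))

  fanMatching : Matching m
  fanMatching = record
    { p        = partner
    ; invol    = λ i → toℕ-injective (fan-unique (partner-fan (partner i)) (fan-sym (partner-fan i)))
    ; noFix    = λ i pi≡i → fan-irrefl (subst (λ v → Fan k (toℕ i) (toℕ v)) pi≡i (partner-fan i))
    ; nonCross = λ i j → fan-nonCross (partner-fan i) (partner-fan j)
    }

  fan-oddOpenings : oddOpenings fanMatching ≡ + k
  fan-oddOpenings = begin
    oddOpenings fanMatching  ≡⟨ sum-cong-≗ (λ i → fan-oddOpening (partner-fan i)) ⟩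
    sum {2 ℕ.* m} (λ i → when (toℕ i <ᵇ suc (k ℕ.* 2)) (odd (toℕ i)))
                             ≡⟨ sum-below {2 ℕ.* m} (suc (k ℕ.* 2)) odd (ℕ.≤-trans (ℕ.n≤1+n _) (subst (suc k ℕ.* 2 ≤_) (ℕ.*-comm m 2) (ℕ.*-monoˡ-≤ 2 k<m))) ⟩
    Σ< (suc (k ℕ.* 2)) odd   ≡⟨ Σ<-odd-suc k ⟩
    + k                      ∎
    where open ≡-Reasoning

  fan-longSigns : longSigns fanMatching ≡ longSign m 0 (suc (k ℕ.* 2))
  fan-longSigns = sum-head _ (ℕ.≤-trans 1≤m (ℕ.m≤m+n m (m ℕ.+ 0))) first (λ i i≢0 → fan-longSign 1≤m i≢0 (partner-fan i))
    where
    1≤m : 1 ≤ m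
    1≤m = ℕ.≤-trans (s≤s z≤n) k<m
    first : ∀ i → toℕ i ≡ 0 → longSign m (toℕ i) (toℕ (partner i)) ≡ longSign m 0 (suc (k ℕ.* 2))
    first i i≡0 = cong₂ (longSign m) i≡0 (fan-unique (subst (λ z → Fan k z (toℕ (partner i))) i≡0 (partner-fan i)) root)

module _ {m h : ℕ} (m≡h*2 : m ≡ h ℕ.* 2) (2≤m : 2 ≤ m) where

  -- The fan with parameter k has N = k, and κ = 1 exactly when its root edge is long, that is, when
  -- h ≤ k. So k = c works for c < h, while for h ≤ c the choice k = c + 1 makes up for κ = 1.
  class-inhabited : ∀ c → c ≤ m ∸ 2 → ∃[ M ] classIndex {m} M ≡ + c
  class-inhabited c c≤m∸2 with ℕ.<-≤-connex c h
  ... | inj₁ c<h = fanMatching c<m , (begin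
    oddOpenings (fanMatching c<m) - longSigns (fanMatching c<m)   ≡⟨ cong₂ _-_ (fan-oddOpenings c<m) (trans (fan-longSigns c<m) short) ⟩
    + c - 0ℤ                                                      ≡⟨ ℤ.+-identityʳ (+ c) ⟩
    + c                                                           ∎)
    where
    open ≡-Reasoning
    c<m : c < m
    c<m = ℕ.<-≤-trans (s≤s c≤m∸2) (ℕ.≤-trans (ℕ.n≤1+n _) (ℕ.≤-reflexive (ℕ.m+[n∸m]≡n 2≤m)))
    short : longSign m 0 (suc (c ℕ.* 2)) ≡ 0ℤ
    short = when-false (<ᵇ-false (ℕ.≤-trans (ℕ.n≤1+n _) (subst (suc c ℕ.* 2 ≤_) (sym m≡h*2) (ℕ.*-monoˡ-≤ 2 c<h))))
  ... | inj₂ h≤c = fanMatching 1+c<m , (begin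
    oddOpenings (fanMatching 1+c<m) - longSigns (fanMatching 1+c<m)   ≡⟨ cong₂ _-_ (fan-oddOpenings 1+c<m) (trans (fan-longSigns 1+c<m) long) ⟩
    + suc c - 1ℤ                                                      ≡⟨⟩
    + c                                                               ∎)
    where
    open ≡-Reasoning
    1+c<m : suc c < m
    1+c<m = ℕ.<-≤-trans (s≤s (s≤s c≤m∸2)) (ℕ.≤-reflexive (ℕ.m+[n∸m]≡n 2≤m))
    long : longSign m 0 (suc (suc c ℕ.* 2)) ≡ 1ℤ
    long = when-true (<ᵇ-true (s≤s (subst (_≤ suc c ℕ.* 2) (sym m≡h*2) (ℕ.*-monoˡ-≤ 2 (ℕ.m≤n⇒m≤1+n h≤c)))))

theorem13 : (m : ℕ) → 2 ∣ m → 2 ≤ m →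
    ((M M' : Matching m) → CenteredFlip M M' →
    ∃[ c ] (c ≤ m ∸ 2 × InClass m c M × InClass m c M'))
    × ((c : ℕ) → c ≤ m ∸ 2 →
    Σ[ M ∈ Matching m ] (InClass m c M × ((M' : Matching m) → Connected M M' → InClass m c M')))
    × (Σ[ f ∈ (Fin (m ∸ 1) → Matching m) ] ((i j : Fin (m ∸ 1)) → i ≢ j → ¬ Connected {m} (f i) (f j)))
theorem13 m (divides h m≡h*2) 2≤m = centeredFlip-InClass {m} {h} m≡h*2 2≤m , component , representative , separated
  where
  witness : ∀ c → c ≤ m ∸ 2 → ∃[ M ] classIndex {m} M ≡ + c
  witness = class-inhabited {m} {h} m≡h*2 2≤m
  component : (c : ℕ) → c ≤ m ∸ 2 →
    Σ[ M ∈ Matching m ] (InClass m c M × ((M' : Matching m) → Connected M M' → InClass m c M'))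
  component c c≤m∸2 with witness c c≤m∸2
  ... | M , index = M , classIndex⇒InClass {m} {h} m≡h*2 2≤m M index ,
    λ M′ path → classIndex⇒InClass {m} {h} m≡h*2 2≤m M′ (trans (sym (connected-classIndex {m} {h} m≡h*2 2≤m path)) index)
  -- The m - 1 indices are exactly the values c = 0, ..., m - 2.
  index≤ : (i : Fin (m ∸ 1)) → toℕ i ≤ m ∸ 2
  index≤ i = subst (toℕ i ≤_) (ℕ.∸-+-assoc m 1 1) (ℕ.<⇒≤pred (toℕ<n i))
  representative : Fin (m ∸ 1) → Matching m
  representative i = proj₁ (witness (toℕ i) (index≤ i))
  separated : ∀ i j → i ≢ j → ¬ Connected {m} (representative i) (representative j)
  -- A path would force equal class indices, but these are i and j by the choice of the
  -- representatives.
  separated i j i≢j path = i≢j (toℕ-injective (ℤ.+-injective (trans (sym (proj₂ (witness (toℕ i) (index≤ i))))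
    (trans (connected-classIndex {m} {h} m≡h*2 2≤m path) (proj₂ (witness (toℕ j) (index≤ j)))))))
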